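{- Let $P$ be a (one-pass) public-coin randomized protocol for $\mathrm{ASCENSION}(n/\log n)$ with worst-case error probability $\frac{1}{42n^2}$. Then $\mathrm{size}=\Omega(n)$, where $\mathrm{size}$ is the bound on the length in bits of each message of the protocol.
   Context: Problem $\mathrm{ASCENSION}(m)$ (here with $m=n/\log n$): there are $2m$ players $A_1,\ldots,A_m$ and $B_1,\ldots,B_m$. Player $A_i$ has $X_i\in\{0,1\}^n$; player $B_i$ has $k_i\in[n]=\{1,\ldots,n\}$, a bit $c_i$, and the prefix $X_i[1,k_i-1]$ of $X_i$. With $\mathbf X=(X_1,\ldots,X_m)$, $\mathbf k=(k_1,\ldots,k_m)$, $\mathbf c=(c_1,\ldots,c_m)$, the goal is to compute $f_m(\mathbf X,\mathbf k,\mathbf c)=\bigvee_{i=1}^m(X_i[k_i]\oplus c_i)$, which is $0$ if $X_i[k_i]=c_i$ for all $i$, and $1$ otherwise. One-pass protocol: motivated by the streaming model, each message is required to have length at most $\mathrm{size}$ bits, where $\mathrm{size}$ is a function of $m$ and $n$ (it corresponds to the allowed space in the corresponding streaming algorithm), and the communication is in the following order. Round 1: for $i$ from $1$ to $m-1$, player $A_i$ sends message $M_{A_i}$ to $B_i$, then $B_i$ sends message $M_{B_i}$ to $A_{i+1}$; then $A_m$ sends message $M_{A_m}$ to $B_m$. Round 2: $B_m$ sends message $M_{B_m}$ to $A_m$; then for $i$ from $m$ down to $2$, $A_i$ sends a message $M'_{A_i}$ to $A_{i-1}$; then $A_1$ computes the output. In a public-coin randomized protocol, the only randomness is a string of public coins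 shared by all players. Worst-case error probability $\delta$ means that on every input the output is wrong with probability at most $\delta$ over the coins.
   Formalization: Each message depends only on the sender's input, the public coins and the message just received; if A_i could recall M_{B_{i-1}} in round 2, B_i could route (k_i, c_i) to A_i via A_{i+1} with O(log n) bits and the claim would fail. -}

module Defs where

open import Data.Bool.Base using (Bool; true; false; _xor_)
open import Data.Bool.ListAction using (any)
open import Data.Bool.Properties using (_≟_)
open import Data.Fin.Base using (Fin; zero; suc; toℕ)
open import Data.Fin.Properties using (toℕ≤n)
open import Data.List.Base
  using (List; []; _∷_; allFin; cartesianProductWith; filter; foldl; foldr; length)
open import Data.Nat.Base using (ℕ; zero; suc; _*_; _^_; _≤_; _<_)
open import Data.Product.Base using (_×_)
open import Data.Vec.Base using (Vec; []; _∷_; lookup; truncate)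
open import Data.Vec.Bounded.Base as Vec≤ using (Vec≤)
open import Relation.Nullary.Decidable.Core using (¬?)

-- m = ⌊n / log₂ n⌋ for n ≥ 2, without real numbers:
-- m ≤ n / log₂ n  iff  m · log₂ n ≤ n  iff  nᵐ ≤ 2ⁿ.
_≡⌊_/log₂⌋ : ℕ → ℕ → Set
m ≡⌊ n /log₂⌋ = n ^ m ≤ 2 ^ n × 2 ^ n < n ^ suc m

-- Players and positions are numbered from 0: k i : Fin n is the position
-- toℕ (k i) + 1 of the 1-based convention.
record Input (m n : ℕ) : Set where
  field
    X : Fin m → Vec Bool n
    k : Fin m → Fin n
    c : Fin m → Bool

-- The bits strictly before position k.
prefix : ∀ {n} → Vec Bool n → (k : Fin n) → Vec Bool (toℕ k)
prefix x k = truncate (toℕ≤n k) x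

f : ∀ {m n} → Input m n → Bool
f {m} input = any (λ i → lookup (X i) (k i) xor c i) (allFin m)
  where open Input input

Message : ℕ → Set
Message size = Vec≤ Bool size

-- What the players do once the public coins are fixed.  As in the streaming
-- model, where a message is the entire memory carried along, each message
-- depends only on the sender's own input and the message just received; in
-- particular Aᵢ does not recall in round 2 what it received in round 1.
-- (If it could, Bᵢ could route kᵢ and cᵢ back to Aᵢ through Aᵢ₊₁ and
-- messages of O(log n) bits would suffice.)
record DeterministicProtocol (m n size : ℕ) : Set where
  field
    -- Round 1: M_{Aᵢ} and M_{Bᵢ}.
    sendA : Fin m → Vec Bool n → Message size → Message size
    sendB : Fin m → (k : Fin n) → Bool → Vec Bool (toℕ k) →
            Message size → Message size
    -- Round 2: M′_{Aᵢ}; the value at i = 0 is never used.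
    sendA′ : Fin m → Vec Bool n → Message size → Message size
    -- Final output, computed by the first A-player.
    output : Vec Bool n → Message size → Bool

run : ∀ {p n size} → DeterministicProtocol (suc p) n size → Input (suc p) n → Bool
run {p} {n} {size} P input = output (X zero) round₂
  where
  open DeterministicProtocol P
  open Input input

  step₁ : Message size → Fin (suc p) → Message size
  step₁ msg i = sendB i (k i) (c i) (prefix (X i) (k i)) (sendA i (X i) msg)

  -- The last M_{B}, sent to the last A-player.  The first A-player has
  -- received nothing, represented by the empty message.
  round₁ : Message size
  round₁ = foldl step₁ Vec≤.[] (allFin (suc p))

  -- foldr visits the A-players from the last one down to index 1.
  round₂ : Message size
  round₂ = foldr (λ j msg → sendA′ (suc j) (X (suc j)) msg) round₁ (allFin p)

record PublicCoinProtocol (m n size : ℕ) : Set where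
  field
    coins : ℕ
    fix   : Vec Bool coins → DeterministicProtocol m n size

bitStrings : ∀ r → List (Vec Bool r)
bitStrings zero    = [] ∷ []
bitStrings (suc r) = cartesianProductWith _∷_ (false ∷ true ∷ []) (bitStrings r)

-- Number of coin strings on which the output is wrong.
errors : ∀ {p n size} → PublicCoinProtocol (suc p) n size → Input (suc p) n → ℕ
errors P input =
  length (filter (λ ω → ¬? (run (fix ω) input ≟ f input)) (bitStrings coins))
  where open PublicCoinProtocol P

-- On every input, errors / 2^coins ≤ 1 / d, with denominators cleared.
WorstCaseError≤1/ : ∀ {p n size} → ℕ → PublicCoinProtocol (suc p) n size → Set
WorstCaseError≤1/ d P = ∀ input → d * errors P input ≤ 2 ^ coins
  where open PublicCoinProtocol P

{-# OPTIONS --safe #-}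

-- Call X and k honest when c i = X i [k i] for all i; then the answer is 0, and
-- flipping a single c i makes it 1.  Fix the coins, an index i, all inputs of
-- the players before i, and the strings of the players after i.  Suppose that
-- x and y are strings for Aᵢ that cause it to send the same message and first
-- differ at position κ.  On (x, κ, x[κ]) and on (y, κ, ¬ y[κ]) the last
-- B-player ends with the same message b, and likewise on (x, κ′, x[κ′]) and
-- (y, κ′, y[κ′]) for κ′ < κ.  So, if the protocol rarely errs with y in place
-- of x, the verdict that y gives to b tells whether kᵢ = κ or kᵢ < κ.  Hence kᵢ
-- can be guessed from b and the fixed data as the last κ at which x has such a
-- y and y answers 1.  As Aᵢ sends few bits, most strings x branch in this way at
-- a constant fraction of the positions (a trie all of whose leaves have at most
-- j branching ancestors has at most 2ʲ leaves), so a constant fraction of all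
-- the kᵢ is guessed correctly.  But among the nᵐ vectors k, a given guessing
-- strategy can be right about many coordinates for only a few, and a message b
-- selects one of at most 2^(size + 1) strategies; therefore size = Ω(m log n).

module Submission where

open import Defs
open import Data.Bool.Base using (Bool; true; false; T; not; _∧_; _∨_; _xor_)
open import Data.Bool.ListAction using (any)
open import Data.Bool.Properties using (T-∧; xor-same; ∧-zeroʳ) renaming (_≟_ to _≟ᵇ_)
open import Data.Empty using (⊥-elim)
open import Data.Fin.Base using (Fin; zero; suc; toℕ)
open import Data.List.Base
  using (List; []; _∷_; _++_; allFin; cartesianProductWith; filter; foldl; foldr; length; map;
         tabulate)
open import Data.List.Membership.Propositional using (_∈_)
open import Data.List.Membership.Propositional.Properties
  using (∈-allFin; ∈-cartesianProductWith⁺)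
open import Data.List.Properties using (length-++; length-map; length-tabulate)
open import Data.List.Relation.Unary.Any using (here; there)
open import Data.Nat.Base
open import Data.Nat.DivMod using (m/n*n≤m; m≡m%n+[m/n]*n; m%n<n)
open import Data.Nat.Properties
open import Data.Nat.Tactic.RingSolver using (solve-∀)
open import Data.Product.Base using (∃; ∃₂; _×_; _,_; proj₁; proj₂)
open import Data.Vec.Base as Vec using (Vec; []; _∷_; lookup; truncate; zipWith)
open import Data.Vec.Bounded.Base as Vec≤ using () renaming (_,_ to _,≤_)
import Data.Vec.Properties as Vec
open import Function.Base using (_∘_; id)
open import Function.Bundles using (module Equivalence)
open import Relation.Binary.Definitions using (DecidableEquality)
open import Relation.Binary.PropositionalEquality
open import Relation.Nullary.Decidable
  using (Dec; yes; no; does; map′; ¬?; ⌊_⌋; toWitness; fromWitness)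
open import Relation.Nullary.Negation using (¬_)

private variable
  A B D : Set
  n : ℕ

-- Finite sums over lists

∑ : List A → (A → ℕ) → ℕ
∑ []       g = 0
∑ (x ∷ xs) g = g x + ∑ xs g

infix 4 _⊑_
_⊑_ : (A → ℕ) → (A → ℕ) → Set
g ⊑ h = ∀ x → g x ≤ h x

∑-mono : ∀ (xs : List A) {g h} → g ⊑ h → ∑ xs g ≤ ∑ xs h
∑-mono []       le = z≤n
∑-mono (x ∷ xs) le = +-mono-≤ (le x) (∑-mono xs le)

∑-cong : ∀ (xs : List A) {g h} → g ≗ h → ∑ xs g ≡ ∑ xs h
∑-cong []       eq = refl
∑-cong (x ∷ xs) eq = cong₂ _+_ (eq x) (∑-cong xs eq)

∑-+ : ∀ (xs : List A) {g h} → ∑ xs (λ x → g x + h x) ≡ ∑ xs g + ∑ xs h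
∑-+ []               = refl
∑-+ (x ∷ xs) {g} {h} =
  trans (cong (g x + h x +_) (∑-+ xs)) (interchange (g x) (h x) (∑ xs g) (∑ xs h))
  where
  interchange : ∀ a b c d → a + b + (c + d) ≡ a + c + (b + d)
  interchange = solve-∀

∑-*ˡ : ∀ (xs : List A) c {g} → ∑ xs (λ x → c * g x) ≡ c * ∑ xs g
∑-*ˡ []       c     = sym (*-zeroʳ c)
∑-*ˡ (x ∷ xs) c {g} = trans (cong (c * g x +_) (∑-*ˡ xs c)) (sym (*-distribˡ-+ c (g x) _))

∑-const : ∀ (xs : List A) c → ∑ xs (λ _ → c) ≡ length xs * c
∑-const []       c = refl
∑-const (x ∷ xs) c = cong (c +_) (∑-const xs c)

∑-zero : ∀ (xs : List A) {g} → (∀ x → g x ≡ 0) → ∑ xs g ≡ 0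
∑-zero []       eq = refl
∑-zero (x ∷ xs) eq rewrite eq x = ∑-zero xs eq

∑-swap : ∀ (xs : List A) (ys : List B) {g : A → B → ℕ} →
  ∑ xs (λ x → ∑ ys (g x)) ≡ ∑ ys (λ y → ∑ xs (λ x → g x y))
∑-swap []       ys = sym (∑-zero ys (λ _ → refl))
∑-swap (x ∷ xs) ys = trans (cong (∑ ys _ +_) (∑-swap xs ys)) (sym (∑-+ ys))

∑-++ : ∀ (xs ys : List A) {g} → ∑ (xs ++ ys) g ≡ ∑ xs g + ∑ ys g
∑-++ []       ys     = refl
∑-++ (x ∷ xs) ys {g} = trans (cong (g x +_) (∑-++ xs ys)) (sym (+-assoc (g x) _ _))

∑-map : ∀ (h : A → B) (xs : List A) {g} → ∑ (map h xs) g ≡ ∑ xs (g ∘ h)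
∑-map h []       = refl
∑-map h (x ∷ xs) = cong (_ +_) (∑-map h xs)

∑-product : ∀ (h : A → B → D) xs ys {g} →
  ∑ (cartesianProductWith h xs ys) g ≡ ∑ xs (λ x → ∑ ys (λ y → g (h x y)))
∑-product h []       ys = refl
∑-product h (x ∷ xs) ys =
  trans (∑-++ (map (h x) ys) _) (cong₂ _+_ (∑-map (h x) ys) (∑-product h xs ys))

term≤∑ : ∀ {xs : List A} {x} g → x ∈ xs → g x ≤ ∑ xs g
term≤∑ g (here refl) = m≤m+n _ _
term≤∑ g (there x∈)  = ≤-trans (term≤∑ g x∈) (m≤n+m _ _)

∑-allFin : ∀ (g : Fin (suc n) → ℕ) →
  ∑ (allFin (suc n)) g ≡ g zero + ∑ (allFin n) (g ∘ suc)
∑-allFin {n} g = cong (g zero +_) (shift id)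
  where
  shift : ∀ {k} (h : Fin k → Fin n) → ∑ (tabulate (suc ∘ h)) g ≡ ∑ (tabulate h) (g ∘ suc)
  shift {zero}  h = refl
  shift {suc k} h = cong (g (suc (h zero)) +_) (shift (h ∘ suc))

length-allFin : ∀ n → length (allFin n) ≡ n
length-allFin n = length-tabulate {n = n} id

-- Enumeration of words and bit strings

words : List A → ∀ m → List (Vec A m)
words xs zero    = [] ∷ []
words xs (suc m) = cartesianProductWith _∷_ xs (words xs m)

∑-words : ∀ (xs : List A) m {g} →
  ∑ (words xs (suc m)) g ≡ ∑ xs (λ x → ∑ (words xs m) (λ w → g (x ∷ w)))
∑-words xs m = ∑-product _∷_ xs (words xs m)

length-product : ∀ (h : A → B → D) xs ys →
  length (cartesianProductWith h xs ys) ≡ length xs * length ys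
length-product h []       ys = refl
length-product h (x ∷ xs) ys = trans (length-++ (map (h x) ys))
  (cong₂ _+_ (length-map (h x) ys) (length-product h xs ys))

length-words-suc : ∀ (xs : List A) m →
  length (words xs (suc m)) ≡ length xs * length (words xs m)
length-words-suc xs m = length-product _∷_ xs (words xs m)

length-words : ∀ (xs : List A) m → length (words xs m) ≡ length xs ^ m
length-words xs zero    = refl
length-words xs (suc m) =
  trans (length-words-suc xs m) (cong (length xs *_) (length-words xs m))

bits : List Bool
bits = false ∷ true ∷ []

bitStrings-words : ∀ n → bitStrings n ≡ words bits n
bitStrings-words zero    = refl
bitStrings-words (suc n) = cong (cartesianProductWith _∷_ bits) (bitStrings-words n)

length-bitStrings : ∀ n → length (bitStrings n) ≡ 2 ^ n
length-bitStrings n = trans (cong length (bitStrings-words n)) (length-words bits n)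

⟦_⟧ : Bool → ℕ
⟦ true  ⟧ = 1
⟦ false ⟧ = 0

⟦⟧≤1 : ∀ b → ⟦ b ⟧ ≤ 1
⟦⟧≤1 true  = ≤-refl
⟦⟧≤1 false = z≤n

⟦∧⟧≤ˡ : ∀ b c → ⟦ b ∧ c ⟧ ≤ ⟦ b ⟧
⟦∧⟧≤ˡ true  c = ⟦⟧≤1 c
⟦∧⟧≤ˡ false c = z≤n

-- Tries of bit strings

data Diverge : ∀ {n} → Vec Bool n → Vec Bool n → Fin n → Set where
  here  : ∀ {n b} {x y : Vec Bool n} → Diverge (b ∷ x) (not b ∷ y) zero
  there : ∀ {n b κ} {x y : Vec Bool n} → Diverge x y κ → Diverge (b ∷ x) (b ∷ y) (suc κ)

-- The two sides truncate along different proofs of the same inequality, which irrelevance of `≤`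
-- identifies.
prefix-∷ : ∀ b (x : Vec Bool n) κ → prefix (b ∷ x) (suc κ) ≡ b ∷ prefix x κ
prefix-∷ b x κ = cong (λ le → truncate le (b ∷ x)) (≤-irrelevant _ (s≤s _))

diverge-lookup : ∀ {x y : Vec Bool n} {κ} → Diverge x y κ → lookup x κ ≡ not (lookup y κ)
diverge-lookup (here {b = true})  = refl
diverge-lookup (here {b = false}) = refl
diverge-lookup (there d)          = diverge-lookup d

diverge-prefix : ∀ {x y : Vec Bool n} {κ} → Diverge x y κ → prefix x κ ≡ prefix y κ
diverge-prefix here = refl
diverge-prefix {κ = suc κ} (there {b = b} {x = x} {y} d) =
  trans (prefix-∷ b x κ) (trans (cong (b ∷_) (diverge-prefix d)) (sym (prefix-∷ b y κ)))

-- Boolean-valued, so that the order can enter indicators under a sum.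
_before_ : Fin n → Fin n → Bool
zero  before zero  = false
zero  before suc _ = true
suc _ before zero  = false
suc i before suc j = i before j

agree-lookup : ∀ {x y : Vec Bool n} {κ} λ′ → Diverge x y κ → T (λ′ before κ) →
  lookup x λ′ ≡ lookup y λ′
agree-lookup zero     (there d) _  = refl
agree-lookup (suc λ′) (there d) lt = agree-lookup λ′ d lt

agree-prefix : ∀ {x y : Vec Bool n} {κ} λ′ → Diverge x y κ → T (λ′ before κ) →
  prefix x λ′ ≡ prefix y λ′
agree-prefix zero (there d) _ = refl
agree-prefix (suc λ′) (there {b = b} {x = x} {y} d) lt =
  trans (prefix-∷ b x λ′)
    (trans (cong (b ∷_) (agree-prefix λ′ d lt)) (sym (prefix-∷ b y λ′)))

inhabited? : (G : Vec Bool n → Bool) → Dec (∃ λ y → T (G y))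
inhabited? {zero} G with G [] in eq
... | true  = yes ([] , subst T (sym eq) _)
... | false = no λ { ([] , t) → subst T eq t }
inhabited? {suc n} G with inhabited? (G ∘ (false ∷_)) | inhabited? (G ∘ (true ∷_))
... | yes (y , t) | _           = yes (false ∷ y , t)
... | no _        | yes (y , t) = yes (true ∷ y , t)
... | no ¬f       | no ¬t       = no λ where
  (false ∷ y , t) → ¬f (y , t)
  (true  ∷ y , t) → ¬t (y , t)

sibling? : (G : Vec Bool n → Bool) (x : Vec Bool n) (κ : Fin n) →
  Dec (∃ λ y → Diverge x y κ × T (G y))
sibling? G (b ∷ x) zero =
  map′ (λ (y , t) → not b ∷ y , here , t) (λ { (_ ∷ y , here , t) → y , t })
    (inhabited? (G ∘ (not b ∷_)))
sibling? G (b ∷ x) (suc κ) =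
  map′ (λ (y , d , t) → b ∷ y , there d , t) (λ { (_ ∷ y , there d , t) → y , d , t })
    (sibling? (G ∘ (b ∷_)) x κ)

-- For `x` accepted by `G`, this is the number of branching ancestors of the leaf `x` in the trie of
-- all strings accepted by `G`.
branches : (Vec Bool n → Bool) → Vec Bool n → ℕ
branches {n} G x = ∑ (allFin n) λ κ → ⟦ does (sibling? G x κ) ⟧

branches-∷ : ∀ (G : Vec Bool (suc n) → Bool) b x →
  branches G (b ∷ x) ≡ ⟦ does (inhabited? (G ∘ (not b ∷_))) ⟧ + branches (G ∘ (b ∷_)) x
branches-∷ G b x = ∑-allFin λ κ → ⟦ does (sibling? G (b ∷ x) κ) ⟧

∑-bitStrings : ∀ n {g} →
  ∑ (bitStrings (suc n)) g
    ≡ ∑ (bitStrings n) (λ x → g (false ∷ x)) + ∑ (bitStrings n) (λ x → g (true ∷ x))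
∑-bitStrings n {g} = trans (∑-product _∷_ bits (bitStrings n))
  (cong (∑ (bitStrings n) (λ x → g (false ∷ x)) +_) (+-identityʳ _))

-- Induction from the root of the trie. If both subtrees of the root are inhabited, every leaf
-- spends one unit of the budget `j` there, and the two bounds `2 ^ (j - 1)` add up; if one subtree
-- is empty, the other keeps the whole budget.
few-branches : ∀ (G : Vec Bool n → Bool) j →
  ∑ (bitStrings n) (λ x → ⟦ G x ∧ (branches G x ≤ᵇ j) ⟧) ≤ 2 ^ j
few-branches {zero}  G j = ≤-trans (≤-reflexive (+-identityʳ _))
  (≤-trans (⟦⟧≤1 (G [] ∧ true)) (m^n>0 2 j))
few-branches {suc n} G j = begin
  ∑ (bitStrings (suc n)) (λ x → ⟦ G x ∧ (branches G x ≤ᵇ j) ⟧)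
    ≡⟨ ∑-bitStrings n ⟩
  half false + half true
    ≡⟨ cong₂ _+_ (half≡ false) (half≡ true) ⟩
  half′ false (does (inhabited? (G ∘ (true ∷_)))) j
    + half′ true (does (inhabited? (G ∘ (false ∷_)))) j
    ≤⟨ cases (inhabited? (G ∘ (false ∷_))) (inhabited? (G ∘ (true ∷_))) j ⟩
  2 ^ j ∎
  where
  open ≤-Reasoning
  half : Bool → ℕ
  half b = ∑ (bitStrings n) λ x → ⟦ G (b ∷ x) ∧ (branches G (b ∷ x) ≤ᵇ j) ⟧

  half′ : Bool → Bool → ℕ → ℕ
  half′ b s j = ∑ (bitStrings n) λ x →
    ⟦ G (b ∷ x) ∧ (⟦ s ⟧ + branches (G ∘ (b ∷_)) x ≤ᵇ j) ⟧

  half≡ : ∀ b → half b ≡ half′ b (does (inhabited? (G ∘ (not b ∷_)))) j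
  half≡ b = ∑-cong (bitStrings n) λ x →
    cong (λ k → ⟦ G (b ∷ x) ∧ (k ≤ᵇ j) ⟧) (branches-∷ G b x)

  empty : ∀ b s j → ¬ (∃ λ y → T (G (b ∷ y))) → half′ b s j ≡ 0
  empty b s j ¬∃ = ∑-zero (bitStrings n) zero′
    where
    zero′ : ∀ x → ⟦ G (b ∷ x) ∧ (⟦ s ⟧ + branches (G ∘ (b ∷_)) x ≤ᵇ j) ⟧ ≡ 0
    zero′ x with G (b ∷ x) in eq
    ... | true  = ⊥-elim (¬∃ (x , subst T (sym eq) _))
    ... | false = refl

  cases : (d₀ : Dec (∃ λ y → T (G (false ∷ y)))) (d₁ : Dec (∃ λ y → T (G (true ∷ y)))) → ∀ j →
    half′ false (does d₁) j + half′ true (does d₀) j ≤ 2 ^ j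
  cases d₀ (no ¬₁) j rewrite empty true (does d₀) j ¬₁ =
    ≤-trans (≤-reflexive (+-identityʳ _)) (few-branches (G ∘ (false ∷_)) j)
  cases (no ¬₀) d₁@(yes _) j rewrite empty false true j ¬₀ = few-branches (G ∘ (true ∷_)) j
  -- The root branches above every leaf, so no leaf stays within budget 0.
  cases (yes _) (yes _) zero =
    ≤-trans (≤-reflexive (cong₂ _+_ (none false) (none true))) z≤n
    where
    none : ∀ b → half′ b true 0 ≡ 0
    none b = ∑-zero (bitStrings n) λ x → cong ⟦_⟧ (∧-zeroʳ (G (b ∷ x)))
  cases (yes _) (yes _) (suc j) =
    +-mono-≤ (step false)
      (≤-trans (step true) (≤-reflexive (sym (+-identityʳ _))))
    where
    suc-≤ᵇ : ∀ a b → (suc a ≤ᵇ suc b) ≡ (a ≤ᵇ b)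
    suc-≤ᵇ zero    b = refl
    suc-≤ᵇ (suc a) b = refl
    step : ∀ b → half′ b true (suc j) ≤ 2 ^ j
    step b = ≤-trans
      (≤-reflexive (∑-cong (bitStrings n) λ x →
        cong (λ c → ⟦ G (b ∷ x) ∧ c ⟧) (suc-≤ᵇ (branches (G ∘ (b ∷_)) x) j)))
      (few-branches (G ∘ (b ∷_)) j)

-- The last true position of a Boolean function

isLast : (Fin n → Bool) → Fin n → Bool
isLast {suc n} w zero    = w zero ∧ (∑ (allFin n) (⟦_⟧ ∘ w ∘ suc) ≡ᵇ 0)
isLast {suc n} w (suc κ) = isLast (w ∘ suc) κ

isLast≤ : ∀ (w : Fin n → Bool) κ → ⟦ isLast w κ ⟧ ≤ ⟦ w κ ⟧
isLast≤ {suc n} w zero    = ⟦∧⟧≤ˡ (w zero) _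
isLast≤ {suc n} w (suc κ) = isLast≤ (w ∘ suc) κ

last-unique : ∀ (w : Fin n → Bool) → ∑ (allFin n) (⟦_⟧ ∘ isLast w) ≤ 1
last-unique {zero}  w = z≤n
last-unique {suc n} w = ≤-trans (≤-reflexive (∑-allFin (⟦_⟧ ∘ isLast w))) split
  where
  split :
    ⟦ w zero ∧ (∑ (allFin n) (⟦_⟧ ∘ w ∘ suc) ≡ᵇ 0) ⟧ + ∑ (allFin n) (⟦_⟧ ∘ isLast (w ∘ suc)) ≤ 1
  split with ∑ (allFin n) (⟦_⟧ ∘ w ∘ suc) in eq
  ... | zero = ≤-trans (+-mono-≤ (⟦⟧≤1 (w zero ∧ true)) none) ≤-refl
    where
    none : ∑ (allFin n) (⟦_⟧ ∘ isLast (w ∘ suc)) ≤ 0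
    none = ≤-trans (∑-mono (allFin n) (isLast≤ (w ∘ suc))) (≤-reflexive eq)
  ... | suc _ = +-mono-≤ (≤-reflexive (cong ⟦_⟧ (∧-zeroʳ (w zero)))) (last-unique (w ∘ suc))

-- Meant for the claims at the true position: a correct claim becomes the guess unless a later
-- position is claimed too, and the sum is a union bound for that failure.
last-or-later : ∀ (w : Fin n → Bool) κ →
  ⟦ w κ ⟧ ≤ ⟦ isLast w κ ⟧ + ∑ (allFin n) (λ κ′ → ⟦ (κ before κ′) ∧ w κ′ ⟧)
last-or-later {suc n} w zero = ≤-trans go
  (+-monoʳ-≤ ⟦ isLast w zero ⟧
    (≤-reflexive (sym (∑-allFin (λ κ′ → ⟦ (zero before κ′) ∧ w κ′ ⟧)))))
  where
  go : ⟦ w zero ⟧ ≤ ⟦ isLast w zero ⟧ + ∑ (allFin n) (⟦_⟧ ∘ w ∘ suc)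
  go with ∑ (allFin n) (⟦_⟧ ∘ w ∘ suc)
  ... | suc k = ≤-trans (⟦⟧≤1 (w zero)) (≤-trans (s≤s z≤n) (m≤n+m _ _))
  ... | zero with w zero
  ...   | true  = ≤-refl
  ...   | false = z≤n
last-or-later {suc n} w (suc κ) = ≤-trans (last-or-later (w ∘ suc) κ)
  (+-monoʳ-≤ ⟦ isLast w (suc κ) ⟧
    (≤-reflexive (sym (∑-allFin (λ κ′ → ⟦ (suc κ before κ′) ∧ w κ′ ⟧)))))

-- One pair of players as a stage

record Stage (n : ℕ) (M : Set) : Set where
  field
    sendA : Vec Bool n → M → M
    sendB : (κ : Fin n) → Bool → Vec Bool (toℕ κ) → M → M
    -- The second round, read backwards: turns the decision that the earlier
    -- players take on the message leaving this player into their decision on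
    -- the message reaching it.
    test  : (M → Bool) → Vec Bool n → M → Bool

  deliver : M → Vec Bool n → Fin n → Bool → M
  deliver σ x κ c = sendB κ c (prefix x κ) (sendA x σ)

open Stage

-- Default values and elementary inequalities

-- The default `c` stands in where there is no witness. As a function of the decision, it reduces at
-- every occurrence once that decision is split on.
match : ∀ {A C : Set} {P : A → Set} → C → Dec (∃ P) → (A → C) → C
match c (yes (y , _)) g = g y
match c (no _)        g = c

-- Absorption: an error term `c` that makes up at most half of `2 * a` leaves the other half to `b`.
2*-cancel : ∀ {a b c} → 2 * a ≤ b + c → c ≤ a → a ≤ b
2*-cancel {a} {b} {c} le c≤a = +-cancelʳ-≤ a a b (begin
  a + a        ≡⟨ cong (a +_) (+-identityʳ a) ⟨
  2 * a        ≤⟨ le ⟩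
  b + c        ≤⟨ +-monoʳ-≤ b c≤a ⟩
  b + a        ∎)
  where open ≤-Reasoning

^⟦⟧ : ∀ a c → a ^ ⟦ c ⟧ ≤ 1 + a * ⟦ c ⟧
^⟦⟧ a true  = n≤1+n _
^⟦⟧ a false = m≤m+n 1 _

-- Exponential Markov inequality, `r ≤ h + m * a ^ (r - h)` with denominators cleared: the first
-- term suffices for `r ≤ h`, the second otherwise.
markov : ∀ {m} a .{{_ : NonZero a}} h r → r ≤ m → a ^ h * r ≤ a ^ h * h + m * a ^ r
markov {m} a h r r≤m with r ≤? h
... | yes r≤h = ≤-trans (*-monoʳ-≤ (a ^ h) r≤h) (m≤m+n _ _)
... | no  r≰h = ≤-trans (≤-trans
  (*-mono-≤ (^-monoʳ-≤ a (≰⇒≥ r≰h)) r≤m) (≤-reflexive (*-comm (a ^ r) m))) (m≤n+m _ _)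

-- Runs of a sequence of stages

module Game {n : ℕ} {M : Set} (_≟ᴹ_ : DecidableEquality M) where

  private variable
    m : ℕ

  keys : ∀ m → List (Vec (Fin n) m)
  keys = words (allFin n)

  strings : ∀ m → List (Vec (Vec Bool n) m)
  strings = words (bitStrings n)

  honest : ∀ {m} → Vec (Vec Bool n) m → Vec (Fin n) m → Vec Bool m
  honest = zipWith lookup

  final : ∀ {m} → Vec (Stage n M) m → M →
    Vec (Vec Bool n) m → Vec (Fin n) m → Vec Bool m → M
  final []         σ []      []      []      = σ
  final (st ∷ sts) σ (x ∷ X) (κ ∷ k) (c ∷ cs) = final sts (deliver st σ x κ c) X k cs

  -- Composing the tests from the first player onwards yields the whole second round as one decision
  -- on the message of the last B-player.
  verdict : ∀ {m} → Vec (Stage n M) m → (M → Bool) → Vec (Vec Bool n) m → M → Bool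
  verdict []         τ []      = τ
  verdict (st ∷ sts) τ (x ∷ X) = verdict sts (test st τ x) X

  -- Guessing the position at one stage

  module Context {p} (st : Stage n M) (sts : Vec (Stage n M) p)
    (σ : M) (τ : M → Bool) (X : Vec (Vec Bool n) p) where

    -- σ is the message reaching st, τ the decision of the players before st on
    -- the message that st sends back, X the strings of the players after st.

    N : ℕ
    N = length (keys p)

    accepts : Vec Bool n → M → Bool
    accepts x = verdict sts (test st τ x) X

    arrive : Vec Bool n → Fin n → Bool → Vec (Fin n) p → M
    arrive x κ c t = final sts (deliver st σ x κ c) X t (honest X t)

    -- With all other players honest, the correct answer is 0 for the honest bit of this stage and 1
    -- for the flipped one.
    err₀ err₁ : Vec Bool n → Fin n → Vec (Fin n) p → ℕ
    err₀ x κ t = ⟦ accepts x (arrive x κ (lookup x κ) t) ⟧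
    err₁ x κ t = ⟦ not (accepts x (arrive x κ (not (lookup x κ)) t)) ⟧

    ∑∑ : (Fin n → Vec (Fin n) p → ℕ) → ℕ
    ∑∑ g = ∑ (allFin n) λ κ → ∑ (keys p) (g κ)

    ∑∑-+ : ∀ g h → ∑∑ (λ κ t → g κ t + h κ t) ≡ ∑∑ g + ∑∑ h
    ∑∑-+ g h = trans (∑-cong (allFin n) λ κ → ∑-+ (keys p)) (∑-+ (allFin n))

    cost : Vec Bool n → ℕ
    cost x = ∑∑ λ κ t → err₀ x κ t + err₁ x κ t

    -- The threshold ensures that the errors of one sibling spoil at most half of the `N` trials
    -- that a branching position contributes, as `pay≤` records.
    good : Vec Bool n → Bool
    good x = 2 * cost x ≤ᵇ N

    mate : M → Vec Bool n → Bool
    mate a y = good y ∧ ⌊ sendA st y σ ≟ᴹ a ⌋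

    module _ (x : Vec Bool n) where

      sibling : (κ : Fin n) → Dec (∃ λ y → Diverge x y κ × T (mate (sendA st x σ) y))
      sibling = sibling? (mate (sendA st x σ)) x

      -- Siblings y of x at κ answer 1 when k = κ and 0 when k precedes κ, up to the
      -- errors counted by miss and early; so the last claim is the guess for k.
      claim : M → Fin n → Bool
      claim b κ = match false (sibling κ) λ y → accepts y b

      hit : M → Fin n → Bool
      hit b = isLast (claim b)

      hits : ℕ
      hits = ∑∑ λ κ t → ⟦ hit (arrive x κ (lookup x κ) t) κ ⟧

      degree : ℕ
      degree = branches (mate (sendA st x σ)) x

      miss : Fin n → Vec (Fin n) p → ℕ
      miss κ t = match 0 (sibling κ) λ y → err₁ y κ t

      early : Fin n → Fin n → Vec (Fin n) p → ℕ
      early κ′ κ t = match 0 (sibling κ′) λ y → err₀ y κ t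

      -- The cost of the chosen sibling at `κ`; all errors made through that sibling, misses and
      -- early claims alike, are charged to it.
      pay : Fin n → ℕ
      pay κ = match 0 (sibling κ) cost

      mate-sendA : ∀ {y} → T (mate (sendA st x σ) y) → sendA st x σ ≡ sendA st y σ
      mate-sendA {y} t = sym (toWitness {a? = sendA st y σ ≟ᴹ sendA st x σ}
        (proj₂ (Equivalence.to T-∧ t)))

      -- Of the string, the B-player of this stage sees only a prefix and the message of its
      -- A-player. If these coincide, so does everything later in round 1.
      arrive-cong : ∀ {y κ c c′} t → prefix x κ ≡ prefix y κ → T (mate (sendA st x σ) y) →
        c ≡ c′ → arrive x κ c t ≡ arrive y κ c′ t
      arrive-cong {y} {κ} {c} t pre ty refl
        rewrite pre | mate-sendA {y} ty = refl

      -- At the point of divergence the honest bit of `x` is the flipped bit of `y`. So `b` also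
      -- arises from `y` on an input with answer 1, and `y` accepts it unless it errs.
      branch-claims : ∀ κ t →
        ⟦ does (sibling κ) ⟧ ≤ ⟦ claim (arrive x κ (lookup x κ) t) κ ⟧ + miss κ t
      branch-claims κ t with sibling κ
      ... | no _ = z≤n
      ... | yes (y , d , ty)
        rewrite arrive-cong {y} t (diverge-prefix d) ty (diverge-lookup d)
        with accepts y (arrive y κ (not (lookup y κ)) t)
      ...   | true  = s≤s z≤n
      ...   | false = s≤s z≤n

      -- Before the divergence the two strings agree, so `b` also arises from `y` on an honest
      -- input; a claim there is an error of `y`.
      later-claim : ∀ κ κ′ t →
        ⟦ (κ before κ′) ∧ claim (arrive x κ (lookup x κ) t) κ′ ⟧ ≤ early κ′ κ t
      later-claim κ κ′ t with κ before κ′ in lt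
      ... | false = z≤n
      ... | true with sibling κ′
      ...   | no _ = z≤n
      ...   | yes (y , d , ty)
        rewrite arrive-cong {y} t (agree-prefix κ d (subst T (sym lt) _)) ty
                  (agree-lookup κ d (subst T (sym lt) _)) = ≤-refl

      -- A branching position is guessed unless its sibling misses it or the sibling at a later
      -- position claims wrongly.
      branch≤ : ∀ κ t → ⟦ does (sibling κ) ⟧ ≤
        ⟦ hit (arrive x κ (lookup x κ) t) κ ⟧ + (miss κ t + ∑ (allFin n) λ κ′ → early κ′ κ t)
      branch≤ κ t = begin
        ⟦ does (sibling κ) ⟧
          ≤⟨ branch-claims κ t ⟩
        ⟦ claim b κ ⟧ + miss κ t
          ≤⟨ +-monoˡ-≤ (miss κ t) (last-or-later (claim b) κ) ⟩
        ⟦ hit b κ ⟧ + ∑ (allFin n) (λ κ′ → ⟦ (κ before κ′) ∧ claim b κ′ ⟧) + miss κ t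
          ≤⟨ +-monoˡ-≤ (miss κ t) (+-monoʳ-≤ ⟦ hit b κ ⟧
               (∑-mono (allFin n) λ κ′ → later-claim κ κ′ t)) ⟩
        ⟦ hit b κ ⟧ + ∑ (allFin n) (λ κ′ → early κ′ κ t) + miss κ t
          ≡⟨ +-assoc ⟦ hit b κ ⟧ _ _ ⟩
        ⟦ hit b κ ⟧ + (∑ (allFin n) (λ κ′ → early κ′ κ t) + miss κ t)
          ≡⟨ cong (⟦ hit b κ ⟧ +_) (+-comm _ (miss κ t)) ⟩
        ⟦ hit b κ ⟧ + (miss κ t + ∑ (allFin n) (λ κ′ → early κ′ κ t)) ∎
        where
        open ≤-Reasoning
        b = arrive x κ (lookup x κ) t

      failures : ℕ
      failures = ∑∑ λ κ t → miss κ t + ∑ (allFin n) λ κ′ → early κ′ κ t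

      degree≤ : degree * N ≤ hits + failures
      degree≤ = begin
        degree * N
          ≡⟨ *-comm degree N ⟩
        N * degree
          ≡⟨ ∑-*ˡ (allFin n) N ⟨
        ∑ (allFin n) (λ κ → N * ⟦ does (sibling κ) ⟧)
          ≡⟨ ∑-cong (allFin n) (λ κ → ∑-const (keys p) _) ⟨
        ∑∑ (λ κ t → ⟦ does (sibling κ) ⟧)
          ≤⟨ ∑-mono (allFin n) (λ κ → ∑-mono (keys p) (branch≤ κ)) ⟩
        ∑∑ (λ κ t → ⟦ hit (arrive x κ (lookup x κ) t) κ ⟧
                      + (miss κ t + ∑ (allFin n) λ κ′ → early κ′ κ t))
          ≡⟨ ∑∑-+ _ _ ⟩
        hits + failures ∎
        where open ≤-Reasoning

      -- The sibling used at `κ` can miss only there, while its early claims may occur at any true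
      -- position; both are among the errors that its cost counts.
      paid : ∀ κ → ∑ (keys p) (miss κ) + ∑∑ (early κ) ≤ pay κ
      paid κ with sibling κ
      ... | no _ = ≤-reflexive (cong₂ _+_ (∑-zero (keys p) λ _ → refl)
                     (∑-zero (allFin n) λ _ → ∑-zero (keys p) λ _ → refl))
      ... | yes (y , _) = begin
        ∑ (keys p) (err₁ y κ) + ∑∑ (err₀ y)
          ≤⟨ +-monoˡ-≤ _ (term≤∑ (λ κ → ∑ (keys p) (err₁ y κ)) (∈-allFin κ)) ⟩
        ∑∑ (err₁ y) + ∑∑ (err₀ y)
          ≡⟨ +-comm (∑∑ (err₁ y)) _ ⟩
        ∑∑ (err₀ y) + ∑∑ (err₁ y)
          ≡⟨ ∑∑-+ (err₀ y) (err₁ y) ⟨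
        cost y ∎
        where open ≤-Reasoning

      failures≤ : failures ≤ ∑ (allFin n) pay
      failures≤ = begin
        failures
          ≡⟨ ∑∑-+ miss _ ⟩
        ∑∑ miss + ∑∑ (λ κ t → ∑ (allFin n) λ κ′ → early κ′ κ t)
          ≡⟨ cong (∑∑ miss +_) (∑-cong (allFin n) λ κ → ∑-swap (keys p) (allFin n)) ⟩
        ∑∑ miss + ∑ (allFin n) (λ κ → ∑ (allFin n) λ κ′ → ∑ (keys p) (early κ′ κ))
          -- Early claims are regrouped by the position of the sibling that makes them instead of
          -- the true position.
          ≡⟨ cong (∑∑ miss +_) (∑-swap (allFin n) (allFin n)) ⟩
        ∑∑ miss + ∑ (allFin n) (λ κ′ → ∑∑ (early κ′))
          ≡⟨ ∑-+ (allFin n) ⟨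
        ∑ (allFin n) (λ κ → ∑ (keys p) (miss κ) + ∑∑ (early κ))
          ≤⟨ ∑-mono (allFin n) paid ⟩
        ∑ (allFin n) pay ∎
        where open ≤-Reasoning

      pay≤ : ∀ κ → 2 * pay κ ≤ N * ⟦ does (sibling κ) ⟧
      pay≤ κ with sibling κ
      ... | no _ = z≤n
      ... | yes (y , _ , ty) = ≤-trans
        (≤ᵇ⇒≤ (2 * cost y) N (proj₁ (Equivalence.to T-∧ ty)))
        (≤-reflexive (sym (*-identityʳ N)))

      2failures≤ : 2 * failures ≤ degree * N
      2failures≤ = begin
        2 * failures                                   ≤⟨ *-monoʳ-≤ 2 failures≤ ⟩
        2 * ∑ (allFin n) pay                           ≡⟨ ∑-*ˡ (allFin n) 2 ⟨
        ∑ (allFin n) (λ κ → 2 * pay κ)                 ≤⟨ ∑-mono (allFin n) pay≤ ⟩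
        ∑ (allFin n) (λ κ → N * ⟦ does (sibling κ) ⟧)  ≡⟨ ∑-*ˡ (allFin n) N ⟩
        N * degree                                     ≡⟨ *-comm N degree ⟩
        degree * N                                     ∎
        where open ≤-Reasoning

      degree≤2hits : degree * N ≤ 2 * hits
      degree≤2hits = 2*-cancel (begin
        2 * (degree * N)            ≤⟨ *-monoʳ-≤ 2 degree≤ ⟩
        2 * (hits + failures)       ≡⟨ *-distribˡ-+ 2 hits failures ⟩
        2 * hits + 2 * failures     ∎) 2failures≤
        where open ≤-Reasoning

    few : ℕ → M → Vec Bool n → Bool
    few j a x = mate a x ∧ (branches (mate a) x ≤ᵇ j)

    -- Three cases: a string that is not good pays through its cost, a good one with more than `j`
    -- branches pays through `degree≤2hits`, and any other is counted by `few`.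
    string-bound : ∀ j x → suc j * N ≤
      2 * (hits x + suc j * cost x) + suc j * N * ⟦ few j (sendA st x σ) x ⟧
    string-bound j x with 2 * cost x ≤? N | degree x ≤? j
    ... | no bad | _ = ≤-trans (begin
      suc j * N                          ≤⟨ *-monoʳ-≤ (suc j) (≰⇒≥ bad) ⟩
      suc j * (2 * cost x)               ≡⟨ rearr (suc j) (cost x) ⟩
      2 * (suc j * cost x)               ≤⟨ *-monoʳ-≤ 2 (m≤n+m _ (hits x)) ⟩
      2 * (hits x + suc j * cost x)      ∎) (m≤m+n _ _)
      where
      open ≤-Reasoning
      rearr : ∀ a b → a * (2 * b) ≡ 2 * (a * b)
      rearr = solve-∀
    ... | yes _ | no big = ≤-trans (begin
      suc j * N                          ≤⟨ *-monoˡ-≤ N (≰⇒> big) ⟩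
      degree x * N                       ≤⟨ degree≤2hits x ⟩
      2 * hits x                         ≤⟨ *-monoʳ-≤ 2 (m≤m+n (hits x) _) ⟩
      2 * (hits x + suc j * cost x)      ∎) (m≤m+n _ _)
      where open ≤-Reasoning
    ... | yes g | yes small = ≤-trans
      (≤-reflexive (sym (trans (cong (suc j * N *_) few≡1) (*-identityʳ _))))
      (m≤n+m _ _)
      where
      T⇒1 : ∀ {b} → T b → ⟦ b ⟧ ≡ 1
      T⇒1 {true} _ = refl
      few≡1 : ⟦ few j (sendA st x σ) x ⟧ ≡ 1
      few≡1 = T⇒1 (Equivalence.from T-∧
        ( Equivalence.from T-∧
            (≤⇒≤ᵇ g , fromWitness {a? = sendA st x σ ≟ᴹ sendA st x σ} refl)
        , ≤⇒≤ᵇ small))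

    -- By `few-branches`, at most `2 ^ j` strings per message are counted by `few`. The hypothesis
    -- makes these at most half of all strings, so their term is absorbed.
    context-bound : ∀ (ms : List M) → (∀ a → a ∈ ms) → ∀ j →
      2 * (length ms * 2 ^ j) ≤ 2 ^ n →
      2 ^ n * (suc j * N) ≤ 4 * ∑ (bitStrings n) (λ x → hits x + suc j * cost x)
    context-bound ms complete j small = 2*-cancel {c = W * (2 * S)} (begin
      2 * (2 ^ n * W)
        ≡⟨ cong (λ l → 2 * (l * W)) (length-bitStrings n) ⟨
      2 * (length (bitStrings n) * W)
        ≡⟨ cong (2 *_) (∑-const (bitStrings n) W) ⟨
      2 * ∑ (bitStrings n) (λ _ → W)
        ≤⟨ *-monoʳ-≤ 2 (∑-mono (bitStrings n) (string-bound j)) ⟩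
      2 * ∑ (bitStrings n) (λ x → 2 * U x + W * ⟦ few j (sendA st x σ) x ⟧)
        ≡⟨ cong (2 *_) (trans (∑-+ (bitStrings n))
             (cong₂ _+_ (∑-*ˡ (bitStrings n) 2) (∑-*ˡ (bitStrings n) W))) ⟩
      2 * (2 * ∑ (bitStrings n) U + W * S)
        ≡⟨ rearr (∑ (bitStrings n) U) W S ⟩
      4 * ∑ (bitStrings n) U + W * (2 * S) ∎)
      (begin
        W * (2 * S)   ≤⟨ *-monoʳ-≤ W (≤-trans (*-monoʳ-≤ 2 S≤) small) ⟩
        W * 2 ^ n     ≡⟨ *-comm W _ ⟩
        2 ^ n * W     ∎)
      where
      open ≤-Reasoning
      W = suc j * N
      U = λ x → hits x + suc j * cost x
      S = ∑ (bitStrings n) λ x → ⟦ few j (sendA st x σ) x ⟧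
      rearr : ∀ a w s → 2 * (2 * a + w * s) ≡ 4 * a + w * (2 * s)
      rearr = solve-∀
      S≤ : S ≤ length ms * 2 ^ j
      S≤ = begin
        S
          -- The message sent by `x` is replaced by all messages, so that each trie is counted with
          -- its message held fixed.
          ≤⟨ ∑-mono (bitStrings n) (λ x → term≤∑ (λ a → ⟦ few j a x ⟧) (complete (sendA st x σ))) ⟩
        ∑ (bitStrings n) (λ x → ∑ ms λ a → ⟦ few j a x ⟧)
          ≡⟨ ∑-swap (bitStrings n) ms ⟩
        ∑ ms (λ a → ∑ (bitStrings n) λ x → ⟦ few j a x ⟧)
          ≤⟨ ∑-mono ms (λ a → few-branches (mate a) j) ⟩
        ∑ ms (λ a → 2 ^ j)
          ≡⟨ ∑-const ms _ ⟩
        length ms * 2 ^ j ∎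

  -- Counting correct guesses over all stages

  -- The final message `b` is a free argument. For fixed `b` the guess of each coordinate depends
  -- only on earlier coordinates of `k`, so `b` selects a strategy.
  score : Vec (Stage n M) m → M → (M → Bool) → Vec (Vec Bool n) m → M → Vec (Fin n) m → ℕ
  score []         σ τ []      b []      = 0
  score (st ∷ sts) σ τ (x ∷ X) b (κ ∷ k) =
    ⟦ Context.hit st sts σ τ X x b κ ⟧
      + score sts (deliver st σ x κ (lookup x κ)) (test st τ x) X b k

  honest-score : Vec (Stage n M) m → M → (M → Bool) → Vec (Vec Bool n) m → Vec (Fin n) m → ℕ
  honest-score sts σ τ X k = score sts σ τ X (final sts σ X k (honest X k)) k

  mistakes : Vec (Stage n M) m → M → (M → Bool) → Vec (Vec Bool n) m → Vec (Fin n) m → ℕ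
  mistakes []         σ τ []      []      = 0
  mistakes (st ∷ sts) σ τ (x ∷ X) (κ ∷ k) =
    Context.err₀ st sts σ τ X x κ k + Context.err₁ st sts σ τ X x κ k
      + mistakes sts (deliver st σ x κ (lookup x κ)) (test st τ x) X k

  ∑ₛ : (Vec (Vec Bool n) m → Vec (Fin n) m → ℕ) → ℕ
  ∑ₛ {m} g = ∑ (strings m) λ X → ∑ (keys m) (g X)

  ∑ₛ-suc : ∀ (g : Vec (Vec Bool n) (suc m) → Vec (Fin n) (suc m) → ℕ) →
    ∑ₛ g ≡ ∑ (bitStrings n) λ x → ∑ (strings m) λ X → ∑ (allFin n) λ κ → ∑ (keys m) λ k →
      g (x ∷ X) (κ ∷ k)
  ∑ₛ-suc {m} g = trans (∑-words (bitStrings n) m)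
    (∑-cong (bitStrings n) λ x → ∑-cong (strings m) λ X → ∑-words (allFin n) m)

  score≤m : ∀ (sts : Vec (Stage n M) m) σ τ X b k → score sts σ τ X b k ≤ m
  score≤m []         σ τ []      b []      = z≤n
  score≤m (st ∷ sts) σ τ (x ∷ X) b (κ ∷ k) =
    +-mono-≤ (⟦⟧≤1 (Context.hit st sts σ τ X x b κ)) (score≤m sts _ _ X b k)

  -- Exponential moment of the number of correct guesses. By `last-unique` at most one of the `n`
  -- positions is a hit, so each coordinate contributes a factor of at most `n + n`.
  guess-weight : ∀ (sts : Vec (Stage n M) m) σ τ X b →
    ∑ (keys m) (λ k → n ^ score sts σ τ X b k) ≤ (2 * n) ^ m
  guess-weight []         σ τ []      b = ≤-refl
  guess-weight {suc m} (st ∷ sts) σ τ (x ∷ X) b = begin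
    ∑ (keys (suc m)) (λ k → n ^ score (st ∷ sts) σ τ (x ∷ X) b k)
      ≡⟨ ∑-words (allFin n) m ⟩
    ∑ (allFin n) (λ κ → ∑ (keys m) λ k → n ^ (⟦ hit x b κ ⟧ + rest κ k))
      ≡⟨ ∑-cong (allFin n) (λ κ → trans
           (∑-cong (keys m) λ k → ^-distribˡ-+-* n ⟦ hit x b κ ⟧ (rest κ k))
           (∑-*ˡ (keys m) (n ^ ⟦ hit x b κ ⟧))) ⟩
    ∑ (allFin n) (λ κ → n ^ ⟦ hit x b κ ⟧ * ∑ (keys m) λ k → n ^ rest κ k)
      ≤⟨ ∑-mono (allFin n) (λ κ → *-mono-≤ (^⟦⟧ n (hit x b κ)) (guess-weight sts _ _ X b)) ⟩
    ∑ (allFin n) (λ κ → (1 + n * ⟦ hit x b κ ⟧) * (2 * n) ^ m)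
      ≡⟨ ∑-cong (allFin n) (λ κ → *-comm (1 + n * ⟦ hit x b κ ⟧) ((2 * n) ^ m)) ⟩
    ∑ (allFin n) (λ κ → (2 * n) ^ m * (1 + n * ⟦ hit x b κ ⟧))
      ≡⟨ ∑-*ˡ (allFin n) ((2 * n) ^ m) ⟩
    (2 * n) ^ m * ∑ (allFin n) (λ κ → 1 + n * ⟦ hit x b κ ⟧)
      ≡⟨ cong ((2 * n) ^ m *_) (trans (∑-+ (allFin n)) (cong₂ _+_
           (trans (∑-const (allFin n) 1) (trans (*-identityʳ _) (length-allFin n)))
           (∑-*ˡ (allFin n) n))) ⟩
    (2 * n) ^ m * (n + n * ∑ (allFin n) (λ κ → ⟦ hit x b κ ⟧))
      ≤⟨ *-monoʳ-≤ ((2 * n) ^ m) (+-monoʳ-≤ n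
           (*-monoʳ-≤ n (last-unique (claim x b)))) ⟩
    (2 * n) ^ m * (n + n * 1)
      ≡⟨ *-comm ((2 * n) ^ m) _ ⟩
    (n + n * 1) * (2 * n) ^ m
      ≡⟨ cong (λ a → (n + a) * (2 * n) ^ m) (*-comm n 1) ⟩
    (2 * n) * (2 * n) ^ m ∎
    where
    open ≤-Reasoning
    open Context st sts σ τ X
    rest : Fin n → Vec (Fin n) m → ℕ
    rest κ k = score sts (deliver st σ x κ (lookup x κ)) (test st τ x) X b k

  module _ (ms : List M) (complete : ∀ a → a ∈ ms) where

    -- Induction on the stages: `context-bound` handles the first one for each choice of the later
    -- strings, the hypothesis the others for each first string and position. The factor `n` enters
    -- because `context-bound` compares with the number of remaining key vectors alone.
    score-bound : ∀ j → 2 * (length ms * 2 ^ j) ≤ 2 ^ n →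
      ∀ (sts : Vec (Stage n M) m) σ τ →
      m * suc j * (length (strings m) * length (keys m)) ≤
        4 * n * ∑ₛ λ X k → honest-score sts σ τ X k + suc j * mistakes sts σ τ X k
    score-bound j small [] σ τ = z≤n
    score-bound {suc m} j small (st ∷ sts) σ τ = begin
      suc m * suc j * (length (strings (suc m)) * length (keys (suc m)))
        ≡⟨ cong (suc m * suc j *_) (cong₂ _*_
             (trans (length-words-suc (bitStrings n) m) (cong (_* S) (length-bitStrings n)))
             (trans (length-words-suc (allFin n) m) (cong (_* K) (length-allFin n)))) ⟩
      suc m * suc j * ((2 ^ n * S) * (n * K))
        ≡⟨ expand m (suc j) (2 ^ n) S n K ⟩
      n * (S * (2 ^ n * (suc j * K))) + 2 ^ n * (n * (m * suc j * (S * K)))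
        ≤⟨ +-mono-≤ (*-monoʳ-≤ n first) second ⟩
      n * (4 * headSum) + 4 * n * tailSum
        ≡⟨ factor n headSum tailSum ⟩
      4 * n * (headSum + tailSum)
        ≡⟨ cong (4 * n *_) split ⟨
      4 * n * ∑ₛ total ∎
      where
      open ≤-Reasoning
      S = length (strings m)
      K = length (keys m)

      total : Vec (Vec Bool n) (suc m) → Vec (Fin n) (suc m) → ℕ
      total X k = honest-score (st ∷ sts) σ τ X k + suc j * mistakes (st ∷ sts) σ τ X k

      head : Vec Bool n → Vec (Vec Bool n) m → Fin n → Vec (Fin n) m → ℕ
      head x X κ k = ⟦ hit x (arrive x κ (lookup x κ) k) κ ⟧ + suc j * (err₀ x κ k + err₁ x κ k)
        where open Context st sts σ τ X

      tail : Vec Bool n → Fin n → Vec (Vec Bool n) m → Vec (Fin n) m → ℕ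
      tail x κ X k = honest-score sts σ′ τ′ X k + suc j * mistakes sts σ′ τ′ X k
        where
        σ′ = deliver st σ x κ (lookup x κ)
        τ′ = test st τ x

      headSum tailSum : ℕ
      headSum = ∑ (strings m) λ X → ∑ (bitStrings n) λ x →
        Context.hits st sts σ τ X x + suc j * Context.cost st sts σ τ X x
      tailSum = ∑ (bitStrings n) λ x → ∑ (allFin n) λ κ → ∑ₛ (tail x κ)

      expand : ∀ m l w s n k →
        suc m * l * ((w * s) * (n * k)) ≡ n * (s * (w * (l * k))) + w * (n * (m * l * (s * k)))
      expand = solve-∀

      factor : ∀ n a b → n * (4 * a) + 4 * n * b ≡ 4 * n * (a + b)
      factor = solve-∀

      regroup : ∀ a b l c d → a + b + l * (c + d) ≡ a + l * c + (b + l * d)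
      regroup = solve-∀

      head-sum : ∀ x X → ∑ (allFin n) (λ κ → ∑ (keys m) (head x X κ))
        ≡ Context.hits st sts σ τ X x + suc j * Context.cost st sts σ τ X x
      head-sum x X = trans (∑∑-+ _ _) (cong (hits x +_)
        (trans (∑-cong (allFin n) λ κ → ∑-*ˡ (keys m) (suc j)) (∑-*ˡ (allFin n) (suc j))))
        where open Context st sts σ τ X

      split : ∑ₛ total ≡ headSum + tailSum
      split = begin-equality
        ∑ₛ total
          ≡⟨ ∑ₛ-suc total ⟩
        ∑ (bitStrings n) (λ x → ∑ (strings m) λ X → ∑ (allFin n) λ κ → ∑ (keys m) λ k →
          total (x ∷ X) (κ ∷ k))
          ≡⟨ ∑-cong (bitStrings n) (λ x → ∑-cong (strings m) λ X →
               trans (∑-cong (allFin n) λ κ →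
                 trans (∑-cong (keys m) λ k → regroup
                   ⟦ Context.hit st sts σ τ X x
                       (final sts (deliver st σ x κ (lookup x κ)) X k (honest X k)) κ ⟧
                   (honest-score sts (deliver st σ x κ (lookup x κ)) (test st τ x) X k) (suc j)
                   (Context.err₀ st sts σ τ X x κ k + Context.err₁ st sts σ τ X x κ k)
                   (mistakes sts (deliver st σ x κ (lookup x κ)) (test st τ x) X k))
                 (∑-+ (keys m)))
               (∑-+ (allFin n))) ⟩
        ∑ (bitStrings n) (λ x → ∑ (strings m) λ X →
          ∑ (allFin n) (λ κ → ∑ (keys m) (head x X κ))
            + ∑ (allFin n) (λ κ → ∑ (keys m) (tail x κ X)))
          ≡⟨ trans (∑-cong (bitStrings n) λ x → ∑-+ (strings m)) (∑-+ (bitStrings n)) ⟩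
        ∑ (bitStrings n) (λ x → ∑ (strings m) λ X → ∑ (allFin n) λ κ → ∑ (keys m) (head x X κ))
          + ∑ (bitStrings n) (λ x → ∑ (strings m) λ X → ∑ (allFin n) λ κ → ∑ (keys m) (tail x κ X))
          ≡⟨ cong₂ _+_
               (trans (∑-cong (bitStrings n) λ x → ∑-cong (strings m) (head-sum x))
                 (∑-swap (bitStrings n) (strings m)))
               (∑-cong (bitStrings n) λ x → ∑-swap (strings m) (allFin n)) ⟩
        headSum + tailSum ∎

      first : S * (2 ^ n * (suc j * K)) ≤ 4 * headSum
      first = begin
        S * (2 ^ n * (suc j * K))
          ≡⟨ ∑-const (strings m) _ ⟨
        ∑ (strings m) (λ _ → 2 ^ n * (suc j * K))
          ≤⟨ ∑-mono (strings m) (λ X → Context.context-bound st sts σ τ X ms complete j small) ⟩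
        ∑ (strings m) (λ X → 4 * ∑ (bitStrings n) λ x →
          Context.hits st sts σ τ X x + suc j * Context.cost st sts σ τ X x)
          ≡⟨ ∑-*ˡ (strings m) 4 ⟩
        4 * headSum ∎

      second : 2 ^ n * (n * (m * suc j * (S * K))) ≤ 4 * n * tailSum
      second = begin
        2 ^ n * (n * (m * suc j * (S * K)))
          ≡⟨ cong₂ _*_ (length-bitStrings n) (cong (_* (m * suc j * (S * K))) (length-allFin n)) ⟨
        length (bitStrings n) * (length (allFin n) * (m * suc j * (S * K)))
          ≡⟨ trans (∑-cong (bitStrings n) λ _ → ∑-const (allFin n) _) (∑-const (bitStrings n) _) ⟨
        ∑ (bitStrings n) (λ _ → ∑ (allFin n) λ _ → m * suc j * (S * K))
          ≤⟨ ∑-mono (bitStrings n) (λ x → ∑-mono (allFin n) λ κ →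
               score-bound j small sts (deliver st σ x κ (lookup x κ)) (test st τ x)) ⟩
        ∑ (bitStrings n) (λ x → ∑ (allFin n) λ κ → 4 * n * ∑ₛ (tail x κ))
          ≡⟨ trans (∑-cong (bitStrings n) λ x → ∑-*ˡ (allFin n) (4 * n))
               (∑-*ˡ (bitStrings n) (4 * n)) ⟩
        4 * n * tailSum ∎

    -- The final message depends on `k`, so no single strategy is fixed; a union bound over all
    -- messages costs the factor `length ms`.
    honest-weight : ∀ (sts : Vec (Stage n M) m) σ τ X →
      ∑ (keys m) (λ k → n ^ honest-score sts σ τ X k) ≤ length ms * (2 * n) ^ m
    honest-weight {m} sts σ τ X = begin
      ∑ (keys m) (λ k → n ^ honest-score sts σ τ X k)
        ≤⟨ ∑-mono (keys m) (λ k → term≤∑ (λ b → n ^ score sts σ τ X b k) (complete _)) ⟩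
      ∑ (keys m) (λ k → ∑ ms λ b → n ^ score sts σ τ X b k)
        ≡⟨ ∑-swap (keys m) ms ⟩
      ∑ ms (λ b → ∑ (keys m) λ k → n ^ score sts σ τ X b k)
        ≤⟨ ∑-mono ms (guess-weight sts σ τ X) ⟩
      ∑ ms (λ _ → (2 * n) ^ m)
        ≡⟨ ∑-const ms _ ⟩
      length ms * (2 * n) ^ m ∎
      where open ≤-Reasoning

    -- Scores up to the threshold `h` give the first summand; larger ones are controlled by the
    -- exponential moment in `honest-weight`.
    total-score : ∀ .{{_ : NonZero n}} h (sts : Vec (Stage n M) m) σ τ →
      n ^ h * ∑ₛ (honest-score sts σ τ) ≤
        length (strings m) * (length (keys m) * (n ^ h * h) + m * (length ms * (2 * n) ^ m))
    total-score {m} h sts σ τ = begin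
      n ^ h * ∑ₛ (honest-score sts σ τ)
        ≡⟨ trans (∑-cong (strings m) λ X → ∑-*ˡ (keys m) (n ^ h)) (∑-*ˡ (strings m) (n ^ h)) ⟨
      ∑ₛ (λ X k → n ^ h * honest-score sts σ τ X k)
        ≤⟨ ∑-mono (strings m) per-string ⟩
      ∑ (strings m) (λ _ → length (keys m) * (n ^ h * h) + m * (length ms * (2 * n) ^ m))
        ≡⟨ ∑-const (strings m) _ ⟩
      length (strings m) * (length (keys m) * (n ^ h * h) + m * (length ms * (2 * n) ^ m)) ∎
      where
      open ≤-Reasoning
      per-string : ∀ X → ∑ (keys m) (λ k → n ^ h * honest-score sts σ τ X k) ≤
        length (keys m) * (n ^ h * h) + m * (length ms * (2 * n) ^ m)
      per-string X = begin
        ∑ (keys m) (λ k → n ^ h * honest-score sts σ τ X k)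
          ≤⟨ ∑-mono (keys m) (λ k → markov n h _ (score≤m sts σ τ X _ k)) ⟩
        ∑ (keys m) (λ k → n ^ h * h + m * n ^ honest-score sts σ τ X k)
          ≡⟨ trans (∑-+ (keys m)) (cong₂ _+_ (∑-const (keys m) _) (∑-*ˡ (keys m) m)) ⟩
        length (keys m) * (n ^ h * h) + m * ∑ (keys m) (λ k → n ^ honest-score sts σ τ X k)
          ≤⟨ +-monoʳ-≤ (length (keys m) * (n ^ h * h)) (*-monoʳ-≤ m (honest-weight sts σ τ X)) ⟩
        length (keys m) * (n ^ h * h) + m * (length ms * (2 * n) ^ m) ∎

  -- Charging mistakes to inputs of the problem

  value : Vec (Vec Bool n) m → Vec (Fin n) m → Vec Bool m → Bool
  value []      []      []       = false
  value (x ∷ X) (κ ∷ k) (c ∷ cs) = (lookup x κ xor c) ∨ value X k cs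

  -- The inputs on which the argument needs the protocol to be correct; the
  -- honest bits occur once for every flip.
  probes : Vec (Vec Bool n) m → Vec (Fin n) m → List (Vec Bool m)
  probes []      []      = []
  probes (x ∷ X) (κ ∷ k) =
    honest (x ∷ X) (κ ∷ k) ∷ (not (lookup x κ) ∷ honest X k) ∷ map (lookup x κ ∷_) (probes X k)

  length-probes : ∀ (X : Vec (Vec Bool n) m) k → length (probes X k) ≡ m * 2
  length-probes []      []      = refl
  length-probes (x ∷ X) (κ ∷ k) =
    cong (2 +_) (trans (length-map _ (probes X k)) (length-probes X k))

  value-honest : ∀ (X : Vec (Vec Bool n) m) k → value X k (honest X k) ≡ false
  value-honest []      []      = refl
  value-honest (x ∷ X) (κ ∷ k) rewrite xor-same (lookup x κ) = value-honest X k

  wrong : Vec (Stage n M) m → M → (M → Bool) →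
    Vec (Vec Bool n) m → Vec (Fin n) m → Vec Bool m → ℕ
  wrong sts σ τ X k c = ⟦ verdict sts τ X (final sts σ X k c) xor value X k c ⟧

  -- Each stage is judged with all earlier players honest. These contribute `false` to the
  -- disjunction, so an error at one stage is an error of the whole run on an honest input or on one
  -- with a single flip.
  mistakes-probes : ∀ (sts : Vec (Stage n M) m) σ τ X k →
    mistakes sts σ τ X k ≡ ∑ (probes X k) (wrong sts σ τ X k)
  mistakes-probes []         σ τ []      []      = refl
  mistakes-probes (st ∷ sts) σ τ (x ∷ X) (κ ∷ k) = trans
    (cong₂ _+_ (cong₂ _+_
      (xor-false (reply (lookup x κ)) (value-honest (x ∷ X) (κ ∷ k)))
      (xor-true (reply (not (lookup x κ))) (xor-not (lookup x κ) (value X k (honest X k)))))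
      rest)
    (+-assoc (w (honest (x ∷ X) (κ ∷ k))) (w (not (lookup x κ) ∷ honest X k)) _)
    where
    w = wrong (st ∷ sts) σ τ (x ∷ X) (κ ∷ k)
    σ′ = deliver st σ x κ (lookup x κ)

    reply : Bool → Bool
    reply c = accepts x (arrive x κ c k)
      where open Context st sts σ τ X

    xor-false : ∀ b {v} → v ≡ false → ⟦ b ⟧ ≡ ⟦ b xor v ⟧
    xor-false true  refl = refl
    xor-false false refl = refl

    xor-true : ∀ b {v} → v ≡ true → ⟦ not b ⟧ ≡ ⟦ b xor v ⟧
    xor-true true  refl = refl
    xor-true false refl = refl

    xor-not : ∀ b v → (b xor not b) ∨ v ≡ true
    xor-not true  v = refl
    xor-not false v = refl

    rest : mistakes sts σ′ (test st τ x) X k ≡ ∑ (map (lookup x κ ∷_) (probes X k)) w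
    rest = trans (mistakes-probes sts σ′ (test st τ x) X k) (sym (trans
      (∑-map (lookup x κ ∷_) (probes X k))
      (∑-cong (probes X k) λ c → cong
        (λ v → ⟦ verdict sts (test st τ x) X (final sts σ′ X k c) xor (v ∨ value X k c) ⟧)
        (xor-same (lookup x κ)))))

  -- Folds over players as runs of stages

  -- The map `g` places the remaining stages among all `q` indices, so that `back` stays fixed while
  -- the induction passes to `g ∘ suc`.
  verdict-foldr : ∀ {q} (s : Fin m → Stage n M) (back : Fin q → M → M) (g : Fin m → Fin q) X τ b →
    (∀ τ b i → test (s i) τ (lookup X i) b ≡ τ (back (g i) b)) →
    verdict (Vec.tabulate s) τ X b ≡ τ (foldr back b (tabulate g))
  verdict-foldr {zero}  s back g []      τ b eq = refl
  verdict-foldr {suc m} s back g (x ∷ X) τ b eq = trans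
    (verdict-foldr (s ∘ suc) back (g ∘ suc) X _ b (λ τ b i → eq τ b (suc i)))
    (eq τ _ zero)

  final-foldl : ∀ {q} (s : Fin m → Stage n M) (step : M → Fin q → M) (g : Fin m → Fin q) X k c σ →
    (∀ σ i → step σ (g i) ≡ deliver (s i) σ (lookup X i) (lookup k i) (lookup c i)) →
    foldl step σ (tabulate g) ≡ final (Vec.tabulate s) σ X k c
  final-foldl {zero}  s step g []      []      []       σ eq = refl
  final-foldl {suc m} s step g (x ∷ X) (κ ∷ k) (c ∷ cs) σ eq = trans
    (cong (λ σ → foldl step σ (tabulate (g ∘ suc))) (eq σ zero))
    (final-foldl (s ∘ suc) step (g ∘ suc) X k cs _ (λ σ i → eq σ (suc i)))

  value-any : ∀ {q} (p : Fin q → Bool) (g : Fin m → Fin q) X k c →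
    (∀ i → p (g i) ≡ lookup (lookup X i) (lookup k i) xor lookup c i) →
    any p (tabulate g) ≡ value X k c
  value-any {zero}  p g []      []      []       eq = refl
  value-any {suc m} p g (x ∷ X) (κ ∷ k) (c ∷ cs) eq =
    cong₂ _∨_ (eq zero) (value-any p (g ∘ suc) X k cs (eq ∘ suc))

  input : Vec (Vec Bool n) m → Vec (Fin n) m → Vec Bool m → Input m n
  input X k c = record { X = lookup X ; k = lookup k ; c = lookup c }

-- Messages of bounded length

messages : ∀ s → List (Message s)
messages zero    = Vec≤.[] ∷ []
messages (suc s) = Vec≤.[] ∷ cartesianProductWith Vec≤._∷_ bits (messages s)

messages-complete : ∀ {s} (a : Message s) → a ∈ messages s
messages-complete {zero}  ([]    ,≤ _) = here refl
messages-complete {suc s} ([]    ,≤ _) = here refl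
messages-complete {suc s} (b ∷ v ,≤ le) =
  there (∈-cartesianProductWith⁺ Vec≤._∷_ (b∈ b) (messages-complete (v ,≤ s≤s⁻¹ le)))
  where
  b∈ : ∀ b → b ∈ bits
  b∈ false = here refl
  b∈ true  = there (here refl)

length-messages : ∀ s → suc (length (messages s)) ≡ 2 ^ suc s
length-messages zero    = refl
length-messages (suc s) = trans
  (cong (2 +_) (length-product Vec≤._∷_ bits (messages s)))
  (trans (double (length (messages s))) (cong (2 *_) (length-messages s)))
  where
  double : ∀ a → 2 + 2 * a ≡ 2 * suc a
  double = solve-∀

_≟ᵐ_ : ∀ {s} → DecidableEquality (Message s)
_≟ᵐ_ (_,≤_ {length = l} v _) (_,≤_ {length = l′} v′ _) with l ≟ l′
... | no l≢ = no λ { refl → l≢ refl }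
... | yes refl with Vec.≡-dec _≟ᵇ_ v v′
...   | yes refl = yes refl
...   | no v≢    = no λ { refl → v≢ refl }

length-filter : ∀ {A : Set} (u : A → Bool) v xs →
  length (filter (λ a → ¬? (u a ≟ᵇ v)) xs) ≡ ∑ xs λ a → ⟦ u a xor v ⟧
length-filter u v []       = refl
length-filter u v (a ∷ xs) with u a | v | length-filter u v xs
... | true  | true  | eq = eq
... | true  | false | eq = cong suc eq
... | false | true  | eq = cong suc eq
... | false | false | eq = eq

-- A dummy: the test of the first stage ignores the decision passed to it.
reject : ∀ {s} → Message s → Bool
reject _ = false

-- Protocols with fixed coins as sequences of stages

module _ {n s : ℕ} where
  open Game {n} {Message s} _≟ᵐ_

  stage : ∀ {p} → DeterministicProtocol (suc p) n s → Fin (suc p) → Stage n (Message s)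
  stage {p} P i = record { sendA = P.sendA i ; sendB = P.sendB i ; test = back i }
    where
    module P = DeterministicProtocol P
    back : Fin (suc p) → (Message s → Bool) → Vec Bool n → Message s → Bool
    back zero    τ x = P.output x
    back (suc i) τ x = τ ∘ P.sendA′ (suc i) x

  stages : ∀ {p} → DeterministicProtocol (suc p) n s → Vec (Stage n (Message s)) (suc p)
  stages P = Vec.tabulate (stage P)

  run-stages : ∀ {p} (P : DeterministicProtocol (suc p) n s) X k c →
    run P (input X k c) ≡ verdict (stages P) reject X (final (stages P) Vec≤.[] X k c)
  run-stages {p} P (x ∷ X) k c = trans
    (sym (verdict-foldr (stage P ∘ suc) (λ j → P.sendA′ (suc j) (lookup X j)) id X (P.output x) _
      (λ _ _ _ → refl)))
    (cong (verdict (stages P) reject (x ∷ X))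
      (final-foldl (stage P)
        (λ σ i → P.sendB i (lookup k i) (lookup c i) (prefix (lookup (x ∷ X) i) (lookup k i))
                   (P.sendA i (lookup (x ∷ X) i) σ))
        id (x ∷ X) k c Vec≤.[] λ { _ zero → refl ; _ (suc _) → refl }))
    where module P = DeterministicProtocol P

  errors-stages : ∀ {p} (P : PublicCoinProtocol (suc p) n s) X k c →
    errors P (input X k c) ≡ ∑ (bitStrings (PublicCoinProtocol.coins P)) λ ω →
      wrong (stages (PublicCoinProtocol.fix P ω)) Vec≤.[] reject X k c
  errors-stages P X k c = trans
    (length-filter (λ ω → run (fix ω) (input X k c)) (f (input X k c)) (bitStrings coins))
    (∑-cong (bitStrings coins) λ ω → cong₂ (λ r v → ⟦ r xor v ⟧)
      (run-stages (fix ω) X k c) (value-any _ id X k c λ _ → refl))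
    where open PublicCoinProtocol P

-- Arithmetic of the final estimate

m<[1+m/n]*n : ∀ m n .{{_ : NonZero n}} → m < suc (m / n) * n
m<[1+m/n]*n m n =
  ≤-<-trans (≤-reflexive (m≡m%n+[m/n]*n m n)) (+-monoˡ-< (m / n * n) (m%n<n m n))

^-distribʳ-* : ∀ m a b → (a * b) ^ m ≡ a ^ m * b ^ m
^-distribʳ-* zero    a b = refl
^-distribʳ-* (suc m) a b =
  trans (cong (a * b *_) (^-distribʳ-* m a b)) (interchange a b (a ^ m) (b ^ m))
  where
  interchange : ∀ a b c d → a * b * (c * d) ≡ a * c * (b * d)
  interchange = solve-∀

-- Here `t` counts the choices of coins, strings and keys, `H` is the total score and `E` the total
-- number of mistakes. The error bound gives `8 * n * E ≤ m * t`, so mistakes account for at most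
-- half of the estimate.
average-score : ∀ {n m l t H E} .{{_ : NonZero n}} .{{_ : NonZero l}} → n ≤ l * 2 →
  m * l * t ≤ 4 * n * (H + l * E) → 42 * n ^ 2 * E ≤ m * 2 * t → m * t ≤ 16 * H
average-score {n} {m} {l} {t} {H} {E} n≤2l score errs = *-cancelˡ-≤ n (begin
  n * (m * t)            ≤⟨ *-monoˡ-≤ (m * t) n≤2l ⟩
  l * 2 * (m * t)        ≡⟨ r₁ l m t ⟩
  2 * (m * l * t)        ≤⟨ *-monoʳ-≤ 2 mlt≤ ⟩
  2 * (8 * n * H)        ≡⟨ r₂ n H ⟩
  n * (16 * H)           ∎)
  where
  open ≤-Reasoning
  r₁ : ∀ l m t → l * 2 * (m * t) ≡ 2 * (m * l * t)
  r₁ = solve-∀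
  r₂ : ∀ n h → 2 * (8 * n * h) ≡ n * (16 * h)
  r₂ = solve-∀
  r₃ : ∀ n e → 2 * (8 * n * e) ≡ 16 * (n * e)
  r₃ = solve-∀
  r₄ : ∀ n e → 42 * (n * e) * n ≡ 42 * (n * (n * 1)) * e
  r₄ = solve-∀
  r₅ : ∀ m t → m * 2 * t ≡ 2 * (m * t)
  r₅ = solve-∀
  r₆ : ∀ n h l e → 2 * (4 * n * (h + l * e)) ≡ 8 * n * h + l * (8 * n * e)
  r₆ = solve-∀
  r₇ : ∀ l m t → l * (m * t) ≡ m * l * t
  r₇ = solve-∀
  8nE≤ : 8 * n * E ≤ m * t
  8nE≤ = *-cancelˡ-≤ 2 (begin
    2 * (8 * n * E)          ≡⟨ r₃ n E ⟩
    16 * (n * E)             ≤⟨ *-monoˡ-≤ (n * E) (m≤m+n 16 26) ⟩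
    42 * (n * E)             ≤⟨ m≤m*n (42 * (n * E)) n ⟩
    42 * (n * E) * n         ≡⟨ r₄ n E ⟩
    42 * n ^ 2 * E           ≤⟨ errs ⟩
    m * 2 * t                ≡⟨ r₅ m t ⟩
    2 * (m * t)              ∎)
  mlt≤ : m * l * t ≤ 8 * n * H
  mlt≤ = 2*-cancel {c = l * (8 * n * E)} (begin
    2 * (m * l * t)                   ≤⟨ *-monoʳ-≤ 2 score ⟩
    2 * (4 * n * (H + l * E))         ≡⟨ r₆ n H l E ⟩
    8 * n * H + l * (8 * n * E)       ∎)
    (begin
    l * (8 * n * E)   ≤⟨ *-monoʳ-≤ l 8nE≤ ⟩
    l * (m * t)       ≡⟨ r₇ l m t ⟩
    m * l * t         ∎)

-- The average score is at least `m / 16` and at most `h + m * q / a`. As `h` is at most `m / 32`,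
-- the other summand must be at least `m / 32`.
power-bound : ∀ {m t a h H q} .{{_ : NonZero m}} .{{_ : NonZero t}} → h * 32 ≤ m →
  m * t ≤ 16 * H → a * H ≤ t * (a * h + m * q) → a ≤ 32 * q
power-bound {m} {t} {a} {h} {H} {q} 32h≤m lower upper = *-cancelˡ-≤ m (2*-cancel {c = a * (h * 32)} (begin
  2 * (m * a)                         ≤⟨ *-monoʳ-≤ 2 (*-cancelˡ-≤ t scaled) ⟩
  2 * (16 * (a * h + m * q))          ≡⟨ r₁ a h m q ⟩
  m * (32 * q) + a * (h * 32)         ∎)
  (≤-trans (*-monoʳ-≤ a 32h≤m) (≤-reflexive (*-comm a m))))
  where
  open ≤-Reasoning
  r₁ : ∀ a h m q → 2 * (16 * (a * h + m * q)) ≡ m * (32 * q) + a * (h * 32)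
  r₁ = solve-∀
  r₂ : ∀ t m a → t * (m * a) ≡ a * (m * t)
  r₂ = solve-∀
  r₃ : ∀ a h → a * (16 * h) ≡ 16 * (a * h)
  r₃ = solve-∀
  r₄ : ∀ t b → 16 * (t * b) ≡ t * (16 * b)
  r₄ = solve-∀
  scaled : t * (m * a) ≤ t * (16 * (a * h + m * q))
  scaled = begin
    t * (m * a)                   ≡⟨ r₂ t m a ⟩
    a * (m * t)                   ≤⟨ *-monoʳ-≤ a lower ⟩
    a * (16 * H)                  ≡⟨ r₃ a H ⟩
    16 * (a * H)                  ≤⟨ *-monoʳ-≤ 16 upper ⟩
    16 * (t * (a * h + m * q))    ≡⟨ r₄ t (a * h + m * q) ⟩
    t * (16 * (a * h + m * q))    ∎

binary-log : ∀ n → .{{NonZero n}} → ∃ λ ℓ → 2 ^ ℓ ≤ n × n < 2 ^ suc ℓ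
binary-log (suc zero)    = 0 , ≤-refl , ≤-refl
binary-log (suc (suc n)) with binary-log (suc n)
... | ℓ , lo , hi with suc (suc n) <? 2 ^ suc ℓ
...   | yes lt = ℓ , m≤n⇒m≤1+n lo , lt
...   | no  ge = suc ℓ , ≮⇒≥ ge , (begin-strict
  suc (suc n)             ≤⟨ hi ⟩
  2 ^ suc ℓ               <⟨ m<m+n (2 ^ suc ℓ) (m^n>0 2 (suc ℓ)) ⟩
  2 ^ suc ℓ + 2 ^ suc ℓ   ≡⟨ cong (2 ^ suc ℓ +_) (+-identityʳ _) ⟨
  2 * 2 ^ suc ℓ           ∎)
  where open ≤-Reasoning

256ℓ≤2^ℓ : ∀ i → 256 * (12 + i) ≤ 2 ^ (12 + i)
-- The induction starts with 3072 ≤ 4096; the inequality fails at exponent 11.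
256ℓ≤2^ℓ zero    = m≤m+n 3072 1024
256ℓ≤2^ℓ (suc i) = begin
  256 * (13 + i)              ≤⟨ m≤m+n _ (256 * (11 + i)) ⟩
  256 * (13 + i) + 256 * (11 + i)   ≡⟨ r i ⟩
  2 * (256 * (12 + i))        ≤⟨ *-monoʳ-≤ 2 (256ℓ≤2^ℓ i) ⟩
  2 * 2 ^ (12 + i)            ∎
  where
  open ≤-Reasoning
  r : ∀ i → 256 * (13 + i) + 256 * (11 + i) ≡ 2 * (256 * (12 + i))
  r = solve-∀

2^-cancel-≤ : ∀ {a b} → 2 ^ a ≤ 2 ^ b → a ≤ b
2^-cancel-≤ {a} {b} le with a ≤? b
... | yes a≤b = a≤b
... | no  a≰b with () ← <-irrefl refl (<-≤-trans (^-monoʳ-< 2 ≤-refl (≰⇒> a≰b)) le)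

2^-cancel-< : ∀ {a b} → 2 ^ a < 2 ^ b → a < b
2^-cancel-< {a} {b} lt with a <? b
... | yes a<b = a<b
... | no  a≮b with () ← <-irrefl refl (<-≤-trans lt (^-monoʳ-≤ 2 (≮⇒≥ a≮b)))

-- Raising `pow` to the power 32 restores the exponent `m` up to rounding, and `2 ^ n < n ^ suc m`
-- then gives `n < 32 * (s + m + ℓ + 7)`. After multiplication by 4, the term `128 * m` and the
-- remaining terms in `ℓ` are at most `n` each, which leaves `2 * n ≤ 128 * s`.
size-bound : ∀ {n m s ℓ} .{{_ : NonZero n}} → 128 ≤ ℓ → 2 ^ ℓ ≤ n → n < 2 ^ suc ℓ →
  m ≡⌊ n /log₂⌋ → n ^ (m / 32) ≤ 2 ^ (s + m + 6) → n ≤ 64 * s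
size-bound {n} {m} {s} {ℓ} big lo hi (n^m≤ , <n^m) pow = *-cancelˡ-≤ 2
  (+-cancelˡ-≤ (2 * n) (2 * n) (2 * (64 * s)) (begin
    2 * n + 2 * n                               ≡⟨ r₁ n ⟩
    4 * n                                       ≤⟨ *-monoʳ-≤ 4 (<⇒≤ n<) ⟩
    4 * ((s + m + 6) * 32 + suc ℓ * 32)         ≡⟨ r₂ s m ℓ ⟩
    128 * m + (7 * 128 + 128 * ℓ) + 2 * (64 * s) ≤⟨ +-monoˡ-≤ _ (+-mono-≤ 128m≤n const≤n) ⟩
    n + n + 2 * (64 * s)                        ≡⟨ cong (λ a → n + a + 2 * (64 * s)) (+-identityʳ n) ⟨
    2 * n + 2 * (64 * s)                        ∎))
  where
  open ≤-Reasoning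
  h = m / 32
  r₁ : ∀ n → 2 * n + 2 * n ≡ 4 * n
  r₁ = solve-∀
  r₂ : ∀ s m ℓ → 4 * ((s + m + 6) * 32 + suc ℓ * 32) ≡ 128 * m + (7 * 128 + 128 * ℓ) + 2 * (64 * s)
  r₂ = solve-∀
  r₃ : ∀ ℓ → 7 * ℓ + 128 * ℓ + 121 * ℓ ≡ 256 * ℓ
  r₃ = solve-∀
  n< : n < (s + m + 6) * 32 + suc ℓ * 32
  n< = 2^-cancel-< (begin-strict
    2 ^ n                                        <⟨ <n^m ⟩
    n ^ suc m                                    ≤⟨ ^-monoʳ-≤ n (m<[1+m/n]*n m 32) ⟩
    n ^ (suc h * 32)                             ≡⟨ ^-*-assoc n (suc h) 32 ⟨
    (n * n ^ h) ^ 32                             ≡⟨ cong (_^ 32) (*-comm n (n ^ h)) ⟩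
    (n ^ h * n) ^ 32                             ≤⟨ ^-monoˡ-≤ 32 (*-mono-≤ pow (<⇒≤ hi)) ⟩
    (2 ^ (s + m + 6) * 2 ^ suc ℓ) ^ 32           ≡⟨ cong (_^ 32) (^-distribˡ-+-* 2 (s + m + 6) (suc ℓ)) ⟨
    (2 ^ (s + m + 6 + suc ℓ)) ^ 32               ≡⟨ ^-*-assoc 2 (s + m + 6 + suc ℓ) 32 ⟩
    2 ^ ((s + m + 6 + suc ℓ) * 32)               ≡⟨ cong (2 ^_) (*-distribʳ-+ 32 (s + m + 6) (suc ℓ)) ⟩
    2 ^ ((s + m + 6) * 32 + suc ℓ * 32)          ∎)
  -- As `2 ^ ℓ ≤ n`, the bound `n ^ m ≤ 2 ^ n` gives `ℓ * m ≤ n`.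
  128m≤n : 128 * m ≤ n
  128m≤n = 2^-cancel-≤ (begin
    2 ^ (128 * m)      ≤⟨ ^-monoʳ-≤ 2 (*-monoˡ-≤ m big) ⟩
    2 ^ (ℓ * m)        ≡⟨ ^-*-assoc 2 ℓ m ⟨
    (2 ^ ℓ) ^ m        ≤⟨ ^-monoˡ-≤ m lo ⟩
    n ^ m              ≤⟨ n^m≤ ⟩
    2 ^ n              ∎)
  const≤n : 7 * 128 + 128 * ℓ ≤ n
  const≤n = begin
    7 * 128 + 128 * ℓ          ≤⟨ +-monoˡ-≤ (128 * ℓ) (*-monoʳ-≤ 7 big) ⟩
    7 * ℓ + 128 * ℓ            ≤⟨ m≤m+n _ (121 * ℓ) ⟩
    7 * ℓ + 128 * ℓ + 121 * ℓ  ≡⟨ r₃ ℓ ⟩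
    256 * ℓ                    ≡⟨ cong (256 *_) (m+[n∸m]≡n 12≤ℓ) ⟨
    256 * (12 + (ℓ ∸ 12))      ≤⟨ 256ℓ≤2^ℓ (ℓ ∸ 12) ⟩
    2 ^ (12 + (ℓ ∸ 12))        ≡⟨ cong (2 ^_) (m+[n∸m]≡n 12≤ℓ) ⟩
    2 ^ ℓ                      ≤⟨ lo ⟩
    n                          ∎
    where
    12≤ℓ : 12 ≤ ℓ
    12≤ℓ = ≤-trans (m≤m+n 12 116) big

-- Averaging over the coins

module _ {n p s : ℕ} (P : PublicCoinProtocol (suc p) n s) where
  private
    m = suc p


  open PublicCoinProtocol P
  open Game {n} {Message s} _≟ᵐ_

  inputs : ℕ
  inputs = length (strings m) * length (keys m)

  totalScore totalMistakes : ℕ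
  totalScore = ∑ (bitStrings coins) λ ω → ∑ₛ (honest-score (stages (fix ω)) Vec≤.[] reject)
  totalMistakes = ∑ (bitStrings coins) λ ω → ∑ₛ (mistakes (stages (fix ω)) Vec≤.[] reject)

  totalScore-lower : ∀ j → 2 * (length (messages s) * 2 ^ j) ≤ 2 ^ n →
    m * suc j * (2 ^ coins * inputs) ≤ 4 * n * (totalScore + suc j * totalMistakes)
  totalScore-lower j small = begin
    m * suc j * (2 ^ coins * inputs)
      ≡⟨ rearr (m * suc j) (2 ^ coins) inputs ⟩
    2 ^ coins * (m * suc j * inputs)
      ≡⟨ cong (_* (m * suc j * inputs)) (length-bitStrings coins) ⟨
    length (bitStrings coins) * (m * suc j * inputs)
      ≡⟨ ∑-const (bitStrings coins) _ ⟨
    ∑ (bitStrings coins) (λ _ → m * suc j * inputs)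
      ≤⟨ ∑-mono (bitStrings coins) (λ ω →
           score-bound (messages s) messages-complete j small (stages (fix ω)) Vec≤.[] reject) ⟩
    ∑ (bitStrings coins) (λ ω → 4 * n * ∑ₛ λ X k → sc ω X k + suc j * mi ω X k)
      ≡⟨ ∑-*ˡ (bitStrings coins) (4 * n) ⟩
    4 * n * ∑ (bitStrings coins) (λ ω → ∑ₛ λ X k → sc ω X k + suc j * mi ω X k)
      ≡⟨ cong (4 * n *_) (trans (∑-cong (bitStrings coins) linear) (trans (∑-+ (bitStrings coins))
           (cong (totalScore +_) (∑-*ˡ (bitStrings coins) (suc j))))) ⟩
    4 * n * (totalScore + suc j * totalMistakes) ∎
    where
    open ≤-Reasoning
    sc mi : Vec Bool coins → Vec (Vec Bool n) m → Vec (Fin n) m → ℕ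
    sc ω = honest-score (stages (fix ω)) Vec≤.[] reject
    mi ω = mistakes (stages (fix ω)) Vec≤.[] reject
    rearr : ∀ a b c → a * (b * c) ≡ b * (a * c)
    rearr = solve-∀
    linear : ∀ ω → ∑ₛ (λ X k → sc ω X k + suc j * mi ω X k) ≡ ∑ₛ (sc ω) + suc j * ∑ₛ (mi ω)
    linear ω = trans (∑-cong (strings m) λ X → trans (∑-+ (keys m))
        (cong (∑ (keys m) (sc ω X) +_) (∑-*ˡ (keys m) (suc j))))
      (trans (∑-+ (strings m)) (cong (∑ₛ (sc ω) +_) (∑-*ˡ (strings m) (suc j))))

  totalScore-upper : ∀ .{{_ : NonZero n}} h → n ^ h * totalScore ≤
    2 ^ coins * inputs * (n ^ h * h + m * (length (messages s) * 2 ^ m))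
  totalScore-upper h = begin
    n ^ h * totalScore
      ≡⟨ ∑-*ˡ (bitStrings coins) (n ^ h) ⟨
    ∑ (bitStrings coins) (λ ω → n ^ h * ∑ₛ (honest-score (stages (fix ω)) Vec≤.[] reject))
      ≤⟨ ∑-mono (bitStrings coins) (λ ω →
           total-score (messages s) messages-complete h (stages (fix ω)) Vec≤.[] reject) ⟩
    ∑ (bitStrings coins) (λ _ → S * (K * (n ^ h * h) + m * (Q * (2 * n) ^ m)))
      ≡⟨ ∑-const (bitStrings coins) _ ⟩
    length (bitStrings coins) * (S * (K * (n ^ h * h) + m * (Q * (2 * n) ^ m)))
      -- `(2 * n) ^ m` is `2 ^ m` times the number of key vectors, so that number factors out.
      ≡⟨ cong₂ (λ c w → c * (S * (K * (n ^ h * h) + m * (Q * w)))) (length-bitStrings coins)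
           (trans (^-distribʳ-* m 2 n) (cong (2 ^ m *_)
             (sym (trans (length-words (allFin n) m) (cong (_^ m) (length-allFin n)))))) ⟩
    2 ^ coins * (S * (K * (n ^ h * h) + m * (Q * (2 ^ m * K))))
      ≡⟨ rearr (2 ^ coins) S K (n ^ h * h) m Q (2 ^ m) ⟩
    2 ^ coins * inputs * (n ^ h * h + m * (Q * 2 ^ m)) ∎
    where
    open ≤-Reasoning
    S = length (strings m)
    K = length (keys m)
    Q = length (messages s)
    rearr : ∀ c s k a m q w → c * (s * (k * a + m * (q * (w * k)))) ≡ c * (s * k) * (a + m * (q * w))
    rearr = solve-∀

  -- Exchanging the sums puts the coins innermost, where the worst-case bound applies to each probe;
  -- every pair of strings and keys has `m * 2` probes.
  totalMistakes-upper : ∀ d → WorstCaseError≤1/ d P →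
    d * totalMistakes ≤ m * 2 * (2 ^ coins * inputs)
  totalMistakes-upper d small = begin
    d * totalMistakes
      ≡⟨ cong (d *_) exchange ⟩
    d * ∑ₛ (λ X k → ∑ (probes X k) λ c → errors P (input X k c))
      ≡⟨ trans (∑-cong (strings m) λ X → trans (∑-cong (keys m) λ k → ∑-*ˡ (probes X k) d)
             (∑-*ˡ (keys m) d))
           (∑-*ˡ (strings m) d) ⟨
    ∑ₛ (λ X k → ∑ (probes X k) λ c → d * errors P (input X k c))
      ≤⟨ ∑-mono (strings m) (λ X → ∑-mono (keys m) λ k → ∑-mono (probes X k) λ c →
           small (input X k c)) ⟩
    ∑ₛ {m} (λ X k → ∑ (probes X k) λ _ → 2 ^ coins)
      ≡⟨ ∑-cong (strings m) (λ X → ∑-cong (keys m) λ k →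
           trans (∑-const (probes X k) _) (cong (_* 2 ^ coins) (length-probes X k))) ⟩
    ∑ₛ {m} (λ X k → m * 2 * 2 ^ coins)
      ≡⟨ trans (∑-cong (strings m) λ X → ∑-const (keys m) _) (∑-const (strings m) _) ⟩
    length (strings m) * (length (keys m) * (m * 2 * 2 ^ coins))
      ≡⟨ rearr (length (strings m)) (length (keys m)) (m * 2) (2 ^ coins) ⟩
    m * 2 * (2 ^ coins * inputs) ∎
    where
    open ≤-Reasoning
    rearr : ∀ s k m c → s * (k * (m * c)) ≡ m * (c * (s * k))
    rearr = solve-∀
    exchange : totalMistakes ≡ ∑ₛ (λ X k → ∑ (probes X k) λ c → errors P (input X k c))
    exchange = trans (∑-swap (bitStrings coins) (strings m)) (∑-cong (strings m) λ X →
      trans (∑-swap (bitStrings coins) (keys m)) (∑-cong (keys m) λ k →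
      trans (∑-cong (bitStrings coins) λ ω →
        mistakes-probes (stages (fix ω)) Vec≤.[] reject X k)
      (trans (∑-swap (bitStrings coins) (probes X k)) (∑-cong (probes X k) λ c →
        sym (errors-stages P X k c)))))

  inputs>0 : ∀ .{{_ : NonZero n}} → 0 < inputs
  inputs>0 = subst₂ (λ a b → 0 < a * b)
    (sym (trans (length-words (bitStrings n) m) (cong (_^ m) (length-bitStrings n))))
    (sym (trans (length-words (allFin n) m) (cong (_^ m) (length-allFin n))))
    (*-mono-< (m^n>0 (2 ^ n) {{m^n≢0 2 n}} m) (m^n>0 n m))

  lower-bound : ∀ {ℓ} .{{_ : NonZero n}} → 128 ≤ ℓ → 2 ^ ℓ ≤ n → n < 2 ^ suc ℓ →
    m ≡⌊ n /log₂⌋ → WorstCaseError≤1/ (42 * n ^ 2) P → n ≤ 64 * s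
  lower-bound {ℓ} big lo hi m≡ small with (s + 2) * 2 ≤? n
  -- A message bound above roughly `n / 2` is already linear; `8 ≤ n` absorbs the constant.
  ... | no short = +-cancelˡ-≤ n n (64 * s) (begin
    n + n                      ≤⟨ +-mono-≤ (<⇒≤ (≰⇒> short)) (<⇒≤ (≰⇒> short)) ⟩
    (s + 2) * 2 + (s + 2) * 2  ≡⟨ double s ⟩
    8 + 4 * s                  ≤⟨ +-mono-≤ 8≤n (*-monoˡ-≤ s (m≤m+n 4 60)) ⟩
    n + 64 * s                 ∎)
    where
    open ≤-Reasoning
    double : ∀ s → (s + 2) * 2 + (s + 2) * 2 ≡ 8 + 4 * s
    double = solve-∀
    8≤n : 8 ≤ n
    8≤n = ≤-trans (^-monoʳ-≤ 2 (≤-trans (m≤m+n 3 125) big)) lo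
  ... | yes room = size-bound {n} {m} {s} {ℓ} big lo hi m≡ (begin
    n ^ h
      ≤⟨ power-bound {m} {t} {n ^ h} {h} {totalScore} {Q * 2 ^ m}
           (m/n*n≤m m 32) average (totalScore-upper h) ⟩
    32 * (Q * 2 ^ m)             ≤⟨ *-monoʳ-≤ 32 (*-monoˡ-≤ (2 ^ m) Q≤) ⟩
    -- The 6 in the exponent is 5 from the factor 32 and 1 from the at most `2 ^ suc s` messages.
    2 ^ 5 * (2 ^ suc s * 2 ^ m)  ≡⟨ cong (2 ^ 5 *_) (^-distribˡ-+-* 2 (suc s) m) ⟨
    2 ^ 5 * 2 ^ (suc s + m)      ≡⟨ ^-distribˡ-+-* 2 5 (suc s + m) ⟨
    2 ^ (6 + (s + m))            ≡⟨ cong (2 ^_) (+-comm 6 (s + m)) ⟩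
    2 ^ (s + m + 6)              ∎)
    where
    open ≤-Reasoning
    -- Half of the average score `m / 16`, as `power-bound` requires.
    h = m / 32
    -- Large enough for `suc j` to be at least half of `n`, and small enough that `2 ^ j` strings
    -- for each message fill at most half of all strings.
    j = n / 2
    Q = length (messages s)
    t = 2 ^ coins * inputs

    instance
      t≢0 : NonZero t
      t≢0 = m*n≢0 _ _ {{m^n≢0 2 coins}} {{>-nonZero inputs>0}}

    Q≤ : Q ≤ 2 ^ suc s
    Q≤ = ≤-trans (n≤1+n Q) (≤-reflexive (length-messages s))

    2+s+j≤n : 2 + (s + j) ≤ n
    2+s+j≤n = *-cancelʳ-≤ (2 + (s + j)) n 2 (begin
      (2 + (s + j)) * 2      ≡⟨ split s j ⟩
      (s + 2) * 2 + j * 2    ≤⟨ +-mono-≤ room (m/n*n≤m n 2) ⟩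
      n + n                  ≡⟨ cong (n +_) (+-identityʳ n) ⟨
      2 * n                  ≡⟨ *-comm 2 n ⟩
      n * 2                  ∎)
      where
      split : ∀ s j → (2 + (s + j)) * 2 ≡ (s + 2) * 2 + j * 2
      split = solve-∀

    memory : 2 * (Q * 2 ^ j) ≤ 2 ^ n
    memory = begin
      2 * (Q * 2 ^ j)              ≤⟨ *-monoʳ-≤ 2 (*-monoˡ-≤ (2 ^ j) Q≤) ⟩
      2 * (2 ^ suc s * 2 ^ j)      ≡⟨ cong (2 *_) (^-distribˡ-+-* 2 (suc s) j) ⟨
      2 ^ (2 + (s + j))            ≤⟨ ^-monoʳ-≤ 2 2+s+j≤n ⟩
      2 ^ n                        ∎

    average : m * t ≤ 16 * totalScore
    average = average-score {n} {m} {suc j} {t} {totalScore} {totalMistakes}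
      (<⇒≤ (m<[1+m/n]*n n 2)) (totalScore-lower j memory)
      (totalMistakes-upper (42 * n ^ 2) small)

theorem4 : ∃₂ λ (C n₀ : ℕ) → ∀ (n p size : ℕ) → n₀ ≤ n →
    let m = suc p in
    m ≡⌊ n /log₂⌋ →
    (P : PublicCoinProtocol m n size) →
    WorstCaseError≤1/ (42 * n ^ 2) P →
    n ≤ C * size
-- The factor 64 is that of `size-bound`, and `2 ^ 128` makes the binary logarithm at least 128.
theorem4 = 64 , 2 ^ 128 , main 128 ≤-refl
  where
  -- A variable exponent keeps the threshold symbolic.
  main : ∀ e → 128 ≤ e → ∀ n p size → 2 ^ e ≤ n → suc p ≡⌊ n /log₂⌋ →
    (P : PublicCoinProtocol (suc p) n size) → WorstCaseError≤1/ (42 * n ^ 2) P → n ≤ 64 * size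
  main e 128≤e n p size big m≡ P small = go {{>-nonZero (≤-trans (m^n>0 2 e) big)}}
    where
    go : .{{_ : NonZero n}} → n ≤ 64 * size
    go with binary-log n
    ... | ℓ , lo , hi = lower-bound P {ℓ}
      (≤-trans 128≤e (s≤s⁻¹ (2^-cancel-< {e} {suc ℓ} (≤-<-trans big hi)))) lo hi m≡ small
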